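{- For every fixed constant positive integer $c$, there is a polynomial time algorithm which, given a tree $T$, decides whether $wr(T)\le c$.
   Context: All graphs are finite, simple and undirected. For a set $E'$ of edges of a graph, the subgraph induced by $E'$ is the graph whose edge set is $E'$ and whose vertex set is the set of endpoints of edges in $E'$. A graph is weakly semiregular if there are two numbers $a,b$ (not necessarily distinct) such that the degree of every vertex is $a$ or $b$. The weakly semiregular number $wr(G)$ of a graph $G$ is the minimum number of subsets into which $E(G)$ can be partitioned so that the subgraph induced by each subset is weakly semiregular. -}

module Defs where

open import Data.Bool.Base using (Bool; true; false; T; if_then_else_)
open import Data.Fin.Base using (Fin; fromℕ<; remQuot)
open import Data.Fin.Subset using (Subset; _∈_; ∣_∣; Nonempty)
open import Data.Fin.Subset.Properties using (nonempty?)
open import Data.List.Base using (List; []; _∷_; _++_; length)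
open import Data.List.Relation.Unary.Linked using (Linked)
open import Data.List.Relation.Unary.Unique.Propositional using (Unique)
open import Data.Nat.Base using (ℕ; _+_; _*_; _∸_; _≤_)
open import Data.Nat.Properties using (_≟_; _<?_)
open import Data.Product.Base using (_×_; _,_; ∃-syntax; uncurry)
open import Data.Sum.Base using (_⊎_)
open import Data.Vec.Base using (tabulate)
open import Data.Vec.Properties using (lookup∘tabulate; lookup⇒[]=)
open import Relation.Binary.Construct.Closure.ReflexiveTransitive using (Star)
open import Relation.Binary.PropositionalEquality using (_≡_; _≢_; trans)
open import Relation.Nullary using (¬_; yes; no; does)
open import Relation.Nullary.Decidable using (dec-true)

-- A set of unordered pairs of distinct labels in Fin n.
record EdgeSet (n : ℕ) : Set where
  field
    joins  : Fin n → Fin n → Bool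
    sym    : ∀ {u v} → T (joins u v) → T (joins v u)
    irrefl : ∀ {u} → ¬ T (joins u u)

  _~_ : Fin n → Fin n → Set
  u ~ v = T (joins u v)

  neighbours : Fin n → Subset n
  neighbours u = tabulate (joins u)

open EdgeSet public using (neighbours)

-- A graph whose vertices are some of the labels in Fin n, so that a subgraph
-- may have fewer vertices than the graph containing it.
record Graph (n : ℕ) : Set where
  field
    vertices : Subset n
    edges    : EdgeSet n
    endpoint : ∀ {u v} → EdgeSet._~_ edges u v → u ∈ vertices

  open EdgeSet edges public using (_~_)

  degree : Fin n → ℕ
  degree v = ∣ neighbours edges v ∣

open Graph public using (vertices; edges; degree)

endpoints : ∀ {n} → EdgeSet n → Subset n
endpoints E = tabulate λ u → does (nonempty? (neighbours E u))

induced : ∀ {n} → EdgeSet n → Graph n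
induced E = record
  { vertices = endpoints E
  ; edges    = E
  ; endpoint = λ {u} {v} u~v →
      lookup⇒[]= u (endpoints E)
        (trans (lookup∘tabulate _ u)
               (dec-true (nonempty? (neighbours E u)) (v , neighbour u~v)))
  }
  where
  T⇒≡true : ∀ {b} → T b → b ≡ true
  T⇒≡true {true} _ = _≡_.refl

  neighbour : ∀ {u v} → EdgeSet._~_ E u v → v ∈ neighbours E u
  neighbour {u} {v} u~v =
    lookup⇒[]= v (neighbours E u) (trans (lookup∘tabulate _ v) (T⇒≡true u~v))

module _ {n : ℕ} (G : Graph n) where
  open Graph G using (_~_)

  Connected : Set
  Connected = Nonempty (vertices G) ×
              (∀ {u v} → u ∈ vertices G → v ∈ vertices G → Star _~_ u v)

  -- The closed walk u, v₁, …, vₘ, u with m ≥ 2 and u, v₁, …, vₘ distinct.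
  IsCycle : Fin n → List (Fin n) → Set
  IsCycle u vs = 2 ≤ length vs × Unique (u ∷ vs) × Linked _~_ (u ∷ vs ++ u ∷ [])

  IsTree : Set
  IsTree = Connected × (∀ u vs → ¬ IsCycle u vs)

WeaklySemiregular : ∀ {n} → Graph n → Set
WeaklySemiregular G =
  ∃[ a ] ∃[ b ] (∀ {v} → v ∈ vertices G → degree G v ≡ a ⊎ degree G v ≡ b)

-- Parts may be empty; discarding empty parts shows that this does not affect
-- the minimum number of parts.
record Partition {n : ℕ} (E : EdgeSet n) (k : ℕ) : Set where
  open EdgeSet using (_~_)
  field
    part     : Fin k → EdgeSet n
    within   : ∀ i {u v} → _~_ (part i) u v → _~_ E u v
    covers   : ∀ {u v} → _~_ E u v → ∃[ i ] _~_ (part i) u v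
    disjoint : ∀ {i j u v} → _~_ (part i) u v → _~_ (part j) u v → i ≡ j

WeaklySemiregularPartition : ∀ {n} → Graph n → ℕ → Set
WeaklySemiregularPartition G k =
  ∃[ P ] (∀ i → WeaklySemiregular (induced (Partition.part {E = edges G} {k} P i)))

-- wr(G) = k
_HasWr_ : ∀ {n} → Graph n → ℕ → Set
G HasWr k = WeaklySemiregularPartition G k ×
            (∀ j → WeaklySemiregularPartition G j → k ≤ j)

-- wr(G) ≤ c
WrAtMost : ∀ {n} → ℕ → Graph n → Set
WrAtMost c G = ∃[ k ] (G HasWr k × k ≤ c)

-- Structured programs for a random access machine with addition and
-- subtraction, charged one unit per executed instruction or test.  There is no
-- multiplication: each step at most doubles the largest stored number (or
-- writes a constant of the program), so stored numbers have length linear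
-- in the running time plus the input length, and polynomial time here agrees
-- with polynomial time on Turing machines.
-- A program text mentions finitely many variables and arrays; the arrays
-- stand for interleaved regions of the machine's memory.

Var Arr : Set
Var = ℕ
Arr = ℕ

infix  6 _⊕_ _⊖_
infix  5 _≔_ _[_]≔_
infixr 4 _⨾_

data Expr : Set where
  const   : ℕ → Expr
  var     : Var → Expr
  _⊕_ _⊖_ : Var → Var → Expr
  load    : Arr → Var → Expr

data Program : Set where
  _≔_     : Var → Expr → Program
  _[_]≔_  : Arr → Var → Var → Program
  _⨾_     : Program → Program → Program
  ifNZ    : Var → Program → Program → Program
  whileNZ : Var → Program → Program

record Store : Set where
  constructor ⟨_,_⟩
  field
    vars   : Var → ℕ
    arrays : Arr → ℕ → ℕ

open Store public

infixl 7 _[_↦_]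

_[_↦_] : {A : Set} → (ℕ → A) → ℕ → A → (ℕ → A)
(f [ x ↦ a ]) y = if does (x ≟ y) then a else f y

eval : Expr → Store → ℕ
eval (const k)  s = k
eval (var x)    s = vars s x
eval (x ⊕ y)    s = vars s x + vars s y
eval (x ⊖ y)    s = vars s x ∸ vars s y
eval (load a x) s = arrays s a (vars s x)

assign : Var → ℕ → Store → Store
assign x k s = ⟨ vars s [ x ↦ k ] , arrays s ⟩

store : Arr → ℕ → ℕ → Store → Store
store a i k s = ⟨ vars s , arrays s [ a ↦ arrays s a [ i ↦ k ] ] ⟩

-- P , s ⇓[ t ] s′ : started in store s, P halts in store s′ after t steps.
infix 3 _,_⇓[_]_

data _,_⇓[_]_ : Program → Store → ℕ → Store → Set where
  assign⇓ : ∀ {x e s} →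
    x ≔ e , s ⇓[ 1 ] assign x (eval e s) s
  store⇓  : ∀ {a x y s} →
    a [ x ]≔ y , s ⇓[ 1 ] store a (vars s x) (vars s y) s
  seq⇓    : ∀ {P Q s s′ s″ t t′} →
    P , s ⇓[ t ] s′ → Q , s′ ⇓[ t′ ] s″ →
    P ⨾ Q , s ⇓[ t + t′ ] s″
  then⇓   : ∀ {x P Q s s′ t} → vars s x ≢ 0 → P , s ⇓[ t ] s′ →
    ifNZ x P Q , s ⇓[ 1 + t ] s′
  else⇓   : ∀ {x P Q s s′ t} → vars s x ≡ 0 → Q , s ⇓[ t ] s′ →
    ifNZ x P Q , s ⇓[ 1 + t ] s′
  loop⇓   : ∀ {x P s s′ s″ t t′} → vars s x ≢ 0 →
    P , s ⇓[ t ] s′ → whileNZ x P , s′ ⇓[ t′ ] s″ →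
    whileNZ x P , s ⇓[ 1 + t + t′ ] s″
  exit⇓   : ∀ {x P s} → vars s x ≡ 0 →
    whileNZ x P , s ⇓[ 1 ] s

-- A graph on all of Fin n is given to a program by n in variable 0 and its
-- n × n adjacency matrix, row by row, in array 0; everything else is 0.
matrixCell : ∀ {n} → Graph n → ℕ → ℕ
matrixCell {n} G i with i <? n * n
... | yes i<n² = if uncurry (EdgeSet.joins (edges G)) (remQuot {n} n (fromℕ< i<n²))
                 then 1 else 0
... | no  _    = 0

input : ∀ {n} → Graph n → Store
input {n} G = ⟨ (λ _ → 0) [ 0 ↦ n ] , (λ _ _ → 0) [ 0 ↦ matrixCell G ] ⟩

-- By convention a program accepts when variable 0 is nonzero at the end.
Accepting : Store → Set
Accepting s = vars s 0 ≢ 0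

{-# OPTIONS --safe #-}
module Submission where

-- Dynamic programming on a tree T rooted anywhere.  Fix target degrees a j and b j for every colour
-- j; they may be taken below n, so there are at most n^(2c) choices.  For a vertex v with parent u,
-- consider the vectors k of colour multiplicities that can arise on the edges from v to its first
-- few children when the subtrees of these children are coloured correctly.  Since c is fixed there
-- are polynomially many tuples (a, b, k, u, v, w), where w is the last child admitted, and those
-- that are realisable form the least fixed point of a first-order operator over the ordered vertex
-- set.  A program evaluates a fixed first-order formula by nested loops over the vertices, hence in
-- polynomial time, and n² sweeps over all tuples reach the fixed point, because each tuple depends
-- only on the tuples with smaller w at the same vertex and on the tuples at its children.
-- The operator does not need to know the root: it treats every ordered pair (u, v) as a parent and
-- its child, and only soundness and completeness refer to a rooted tree.

open import Defs
open import Data.Bool.Base using (Bool; true; false; if_then_else_; not; _∧_)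
open import Data.Bool.Properties using (T?; T-≡; ∧-zeroʳ; ∧-identityʳ)
open import Data.Empty using (⊥-elim)
open import Data.Fin.Base as Fin using (Fin; toℕ; fromℕ<; zero; suc; combine; remQuot)
open import Data.Fin.Properties as Finₚ using (toℕ<n; toℕ-fromℕ<; toℕ-injective)
open import Data.Fin.Subset as Subset using (Subset; ∣_∣; Nonempty)
open import Data.Fin.Subset.Properties using (nonempty?; x∈p⇒∣p-x∣<∣p∣; ∣p∣≤n; ∈⊤)
open import Data.List.Base as List using (List; []; _∷_; _++_; length)
import Data.List.Membership.DecPropositional as DecMembership
open import Data.List.Membership.Propositional using (_∈_; _∉_)
open import Data.List.Membership.Propositional.Properties using (∈-lookup)
open import Data.List.Relation.Unary.All as All using (All; []; _∷_)
open import Data.List.Relation.Unary.All.Properties as Allₚ using (¬Any⇒All¬)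
open import Data.List.Relation.Unary.AllPairs using ([]; _∷_)
open import Data.List.Relation.Unary.Any using (here; there)
open import Data.List.Relation.Unary.Linked using (Linked; [-]; _∷_)
open import Data.List.Relation.Unary.Unique.Propositional using (Unique)
import Data.List.Relation.Unary.Unique.Propositional.Properties as Uniqueₚ
open import Data.Maybe.Base using (Maybe; just; nothing)
open import Data.Maybe.Properties using (just-injective; ≡-dec)
open import Data.Nat.Base
open import Data.Nat.DivMod using ([m+kn]%n≡m%n; m<n⇒m%n≡m)
open import Data.Nat.ListAction using (sum)
open import Data.Nat.Properties
open import Data.Product.Base using (_×_; _,_; ∃-syntax; proj₁; proj₂; map₂; uncurry)
open import Data.Sum.Base as Sum using (_⊎_; inj₁; inj₂)
open import Data.Unit.Base using (tt)
open import Data.Vec.Base using (Vec; []; _∷_; lookup; tabulate)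
open import Data.Vec.Properties using (tabulate-cong; lookup∘tabulate; []=⇒lookup; lookup⇒[]=)
open import Function.Base using (_∘_; id; _∋_; case_of_)
open import Function.Bundles using (_⇔_; mk⇔; Equivalence)
open import Relation.Binary.Construct.Closure.ReflexiveTransitive using (Star; ε; _◅_)
open import Relation.Binary.PropositionalEquality
open import Relation.Nullary using (¬_; Dec; yes; no; does)
open import Relation.Nullary.Decidable using (dec-true; dec-false; does-⇔; map′; ¬?)

open Equivalence using (to; from)

-- Multiplicities and target degrees are less than n, so a state of the recursion is a tuple of
-- vertices, and the table is a relation on vertices just like the input matrix. Hence execution and
-- running time have to be verified only once, for an arbitrary step formula; whatever concerns
-- trees is stated in logic. A correctly coloured vertex may also have multiplicity 0 in a colour,
-- whatever the targets: without an edge of that colour it is not a vertex of the induced subgraph.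
-- `WrAtMost` speaks of the minimum itself, which has to be exhibited. This takes a decision, for
-- every k, whether there is a partition into k classes, and the verified run of the program for k
-- supplies it.

module Machine where
  open import Data.Unit.Base using (⊤)

  private variable
    P Q : Program
    s s′ : Store
    Φ Ψ : Store → Set
    b d n i j T T′ : ℕ
    x y : Var
    e : Expr

  -- Polynomial bounds

  -- Restricted to positive `n`, where a power grows with its exponent; this lets `poly-+` bring two
  -- bounds to a common exponent. A tree has a vertex, so nothing is lost.
  IsPoly : (ℕ → ℕ) → Set
  IsPoly f = ∃[ a ] ∃[ d ] (∀ n → 1 ≤ n → f n ≤ a * n ^ d)

  private variable
    f g : ℕ → ℕ

  poly-const : ∀ k → IsPoly (λ _ → k)
  poly-const k = k , 0 , λ n _ → ≤-reflexive (sym (*-identityʳ k))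

  poly-id : IsPoly (λ n → n)
  poly-id = 1 , 1 , λ n _ → ≤-reflexive (sym (trans (*-identityˡ _) (*-identityʳ n)))

  poly-+ : IsPoly f → IsPoly g → IsPoly (λ n → f n + g n)
  poly-+ {f} {g} (a , d , f≤) (a′ , d′ , g≤) = a + a′ , d + d′ , bound
    where
    open ≤-Reasoning
    bound : ∀ n → 1 ≤ n → f n + g n ≤ (a + a′) * n ^ (d + d′)
    bound n@(suc _) 1≤n = begin
      f n + g n                             ≤⟨ +-mono-≤ (f≤ n 1≤n) (g≤ n 1≤n) ⟩
      a * n ^ d + a′ * n ^ d′               ≤⟨ +-mono-≤ (*-monoʳ-≤ a (^-monoʳ-≤ n (m≤m+n d d′)))
                                                        (*-monoʳ-≤ a′ (^-monoʳ-≤ n (m≤n+m d′ d))) ⟩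
      a * n ^ (d + d′) + a′ * n ^ (d + d′)  ≡⟨ *-distribʳ-+ (n ^ (d + d′)) a a′ ⟨
      (a + a′) * n ^ (d + d′)               ∎

  poly-* : IsPoly f → IsPoly g → IsPoly (λ n → f n * g n)
  poly-* {f} {g} (a , d , f≤) (a′ , d′ , g≤) = a * a′ , d + d′ , bound
    where
    open ≤-Reasoning
    bound : ∀ n → 1 ≤ n → f n * g n ≤ a * a′ * n ^ (d + d′)
    bound n 1≤n = begin
      f n * g n                    ≤⟨ *-mono-≤ (f≤ n 1≤n) (g≤ n 1≤n) ⟩
      a * n ^ d * (a′ * n ^ d′)    ≡⟨ [m*n]*[o*p]≡[m*o]*[n*p] a (n ^ d) a′ (n ^ d′) ⟩
      a * a′ * (n ^ d * n ^ d′)    ≡⟨ cong (a * a′ *_) (^-distribˡ-+-* n d d′) ⟨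
      a * a′ * n ^ (d + d′)        ∎

  -- Bounded total correctness

  Runs : Program → Store → ℕ → (Store → Set) → Set
  Runs P s T Φ = ∃[ t ] ∃[ s′ ] ((P , s ⇓[ t ] s′) × t ≤ T × Φ s′)

  weaken : T ≤ T′ → (∀ {s} → Φ s → Ψ s) → Runs P s T Φ → Runs P s T′ Ψ
  weaken T≤T′ Φ⊆Ψ (t , s′ , run , t≤T , φ) = t , s′ , run , ≤-trans t≤T T≤T′ , Φ⊆Ψ φ

  assigned : Φ (assign x (eval e s) s) → Runs (x ≔ e) s 1 Φ
  assigned φ = 1 , _ , assign⇓ , ≤-refl , φ

  stored : ∀ {a} → Φ (store a (vars s x) (vars s y) s) → Runs (a [ x ]≔ y) s 1 Φ
  stored φ = 1 , _ , store⇓ , ≤-refl , φ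

  infixr 4 _⟫_
  _⟫_ : Runs P s T Φ → (∀ {s} → Φ s → Runs Q s T′ Ψ) → Runs (P ⨾ Q) s (T + T′) Ψ
  (t , s′ , run , t≤T , φ) ⟫ k with k φ
  ... | t′ , s″ , run′ , t′≤T′ , ψ = t + t′ , s″ , seq⇓ run run′ , +-mono-≤ t≤T t′≤T′ , ψ

  -- The bounds of the two branches are added instead of maximised, so that sums and products
  -- suffice for all running times.
  branch : (vars s x ≢ 0 → Runs P s T Φ) → (vars s x ≡ 0 → Runs Q s T′ Φ) →
           Runs (ifNZ x P Q) s (1 + (T + T′)) Φ
  branch {s} {x} {T = T} {T′ = T′} p q with vars s x ≟ 0
  ... | no x≢0 with p x≢0
  ...   | t , s′ , run , t≤T , φ =
    1 + t , s′ , then⇓ x≢0 run , s≤s (≤-trans t≤T (m≤m+n T T′)) , φ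
  branch {s} {x} {T = T} {T′ = T′} p q | yes x≡0 with q x≡0
  ...   | t , s′ , run , t≤T , φ =
    1 + t , s′ , else⇓ x≡0 run , s≤s (≤-trans t≤T (m≤n+m T′ T)) , φ

  -- Memory layout

  -- `flag` is the variable that holds n at the start and the verdict at the end. Variables 6 and 7
  -- count the sweeps, and the tuples bound by quantifiers or by the sweep lie from `base` on.
  pattern flag = 0
  pattern tick = 1
  pattern acc  = 2
  pattern aux  = 3
  pattern size = 4
  pattern one  = 5
  pattern base = 8

  skip : Program
  skip = tick ≔ var tick

  update-≡ : {A : Set} (h : ℕ → A) (x : ℕ) {a : A} → (h [ x ↦ a ]) x ≡ a
  update-≡ h x {a} rewrite dec-true (x ≟ x) refl = refl

  update-≢ : {A : Set} (h : ℕ → A) {x y : ℕ} {a : A} → x ≢ y → (h [ x ↦ a ]) y ≡ h y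
  update-≢ h {x} {y} x≢y rewrite dec-false (x ≟ y) x≢y = refl

  -- The variables 4, …, b ∸ 1 and all arrays have survived; variables below 4 are scratch.
  record Frame (b : ℕ) (s s′ : Store) : Set where
    constructor frame
    field
      mem  : arrays s′ ≡ arrays s
      kept : ∀ {x} → 4 ≤ x → x < b → vars s′ x ≡ vars s x

  open Frame

  Frame-refl : Frame b s s
  Frame-refl = frame refl λ _ _ → refl

  Frame-trans : ∀ {s″} → Frame b s s′ → Frame b s′ s″ → Frame b s s″
  Frame-trans F G = frame (trans (mem G) (mem F)) λ l u → trans (kept G l u) (kept F l u)

  Frame-assign : ∀ {k} → y < 4 ⊎ b ≤ y → Frame b s (assign y k s)
  Frame-assign {s = s} (inj₁ y<4) =
    frame refl λ 4≤x _ → update-≢ (vars s) (<⇒≢ (<-≤-trans y<4 4≤x))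
  Frame-assign {s = s} (inj₂ b≤y) =
    frame refl λ _ x<b → update-≢ (vars s) (≢-sym (<⇒≢ (<-≤-trans x<b b≤y)))

  Frame-≤ : ∀ {b′} → b ≤ b′ → Frame b′ s s′ → Frame b s s′
  Frame-≤ b≤b′ F = frame (mem F) λ l u → kept F l (<-≤-trans u b≤b′)

  record Ready (n : ℕ) (s : Store) : Set where
    constructor ready
    field
      size≡ : vars s size ≡ n
      one≡  : vars s one ≡ 1

  open Ready

  Ready-frame : 6 ≤ b → Frame b s s′ → Ready n s → Ready n s′
  Ready-frame 6≤b F R = ready
    (trans (kept F ≤-refl (<-≤-trans (n<1+n 4) (≤-trans (n≤1+n 5) 6≤b))) (size≡ R))
    (trans (kept F (n≤1+n 4) 6≤b) (one≡ R))

  Block : Store → Var → Vec (Fin n) d → Set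
  Block s p []      = ⊤
  Block s p (x ∷ v) = vars s p ≡ toℕ x × Block s (suc p) v

  Block-frame : ∀ {p} (v : Vec (Fin n) d) → 4 ≤ p → p + d ≤ b → Frame b s s′ →
                Block s p v → Block s′ p v
  Block-frame         []              _   _    _ _          = tt
  Block-frame {d = suc d} {p = p} (x ∷ v) 4≤p p+d≤b F (px , pv) =
    trans (kept F 4≤p (<-≤-trans (m<m+n p (s≤s z≤n)) p+d≤b)) px ,
    Block-frame v (m≤n⇒m≤1+n 4≤p) (≤-trans (≤-reflexive (sym (+-suc p d))) p+d≤b) F pv

  Block-lookup : ∀ {p} (v : Vec (Fin n) d) → Block s p v →
                 ∀ i → vars s (p + toℕ i) ≡ toℕ (lookup v i)
  Block-lookup {s = s} {p} (x ∷ v) (px , pv) zero    = trans (cong (vars s) (+-identityʳ p)) px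
  Block-lookup {s = s} {p} (x ∷ v) (px , pv) (suc i) =
    trans (cong (vars s) (+-suc p (toℕ i))) (Block-lookup v pv i)

  -- Loops

  -- The machine only tests for zero, so `tick` is recomputed as the number of iterations left. The
  -- body may therefore use `tick` freely.
  for : Var → Program → Program
  for x P = x ≔ const 0 ⨾ tick ≔ size ⊖ x ⨾ whileNZ tick (P ⨾ x ≔ x ⊕ one ⨾ tick ≔ size ⊖ x)

  forTime : ℕ → ℕ → ℕ
  forTime n T = 1 + (1 + (1 + n * (1 + (T + (1 + 1)))))

  -- A loop on `x` changes `tick` and `x`, and the loops nested in it change later variables; these
  -- are the assignments that an invariant has to survive.
  Stable : Var → (Store → Set) → Set
  Stable x Φ = ∀ {y k s} → y ≡ tick ⊎ x ≤ y → Φ s → Φ (assign y k s)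

  module _ (x : Var) (J : ℕ → Store → Set) (6≤x : 6 ≤ x)
           (stable : ∀ {i} → Stable x (J i))
           (J-ready : ∀ {i s} → J i s → Ready n s)
           (body : ∀ (i : Fin n) {s} → J (toℕ i) s → vars s x ≡ toℕ i →
                   Runs P s T (λ s′ → J (suc (toℕ i)) s′ × vars s′ x ≡ toℕ i)) where

    private
      x≢ : ∀ {k} → k < 6 → k ≢ x
      x≢ k<6 refl = <⇒≱ k<6 6≤x

      tick-step : vars s x ≡ j → J i s → i ≡ j → ∀ {Φ} →
        (∀ {s′} → J i s′ → vars s′ x ≡ j → vars s′ tick ≡ n ∸ j → Φ s′) →
        Runs (tick ≔ size ⊖ x) s 1 Φ
      tick-step {s} {j} xj J-s refl k = assigned (k (stable (inj₁ refl) J-s)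
        (trans (update-≢ (vars s) (x≢ (s≤s (s≤s z≤n)))) xj)
        (cong₂ _∸_ (size≡ (J-ready J-s)) xj))

      while-runs : ∀ k {i s} → i + k ≡ n → J i s → vars s x ≡ i → vars s tick ≡ k →
        Runs (whileNZ tick (P ⨾ x ≔ x ⊕ one ⨾ tick ≔ size ⊖ x)) s
          (1 + k * (1 + (T + (1 + 1)))) (J n)
      while-runs zero {i} i+0≡n J-s _ t≡0 =
        1 , _ , exit⇓ t≡0 , ≤-refl , subst (λ i → J i _) (trans (sym (+-identityʳ i)) i+0≡n) J-s
      while-runs (suc k) {i} {s} i+k≡n J-s x≡i t≡ with step
        where
        i<n : i < n
        i<n = subst (i <_) i+k≡n (m<m+n i (s≤s z≤n))

        toℕi : toℕ (fromℕ< i<n) ≡ i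
        toℕi = toℕ-fromℕ< i<n

        step : Runs (P ⨾ x ≔ x ⊕ one ⨾ tick ≔ size ⊖ x) s (T + (1 + 1))
          (λ s′ → J (suc i) s′ × vars s′ x ≡ suc i × vars s′ tick ≡ n ∸ suc i)
        step =
          body (fromℕ< i<n) (subst (λ i → J i s) (sym toℕi) J-s) (trans x≡i (sym toℕi))
          ⟫ λ {s₁} (J₁ , x₁) →
          assigned {Φ = λ s → J (suc i) s × vars s x ≡ suc i}
            ( stable (inj₂ ≤-refl) (subst (λ i → J (suc i) s₁) toℕi J₁)
            , trans (update-≡ (vars s₁) x)
                (trans (cong₂ _+_ (trans x₁ toℕi) (one≡ (J-ready J₁))) (+-comm i 1)))
          ⟫ λ (J₂ , x₂) →
          tick-step x₂ J₂ refl (λ J₃ x₃ t₃ → J₃ , x₃ , t₃)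
      ... | t , s₁ , run , t≤ , J₁ , x₁ , t₁
        with while-runs k (trans (sym (+-suc i k)) i+k≡n) J₁ x₁
               (trans t₁ (trans (cong (_∸ suc i) (trans (sym i+k≡n) (+-suc i k)))
                 (m+n∸m≡n (suc i) k)))
      ...   | t′ , s₂ , run′ , t′≤ , J₂ =
        1 + t + t′ , s₂ , loop⇓ (λ z → 1+n≢0 (trans (sym t≡) z)) run run′ ,
        s≤s (≤-trans (+-mono-≤ t≤ t′≤) (≤-reflexive (+-suc (T + 2) _))) , J₂

    for-runs : J 0 s → Runs (for x P) s (forTime n T) (J n)
    for-runs {s} J₀ =
      assigned {Φ = λ s → J 0 s × vars s x ≡ 0} (stable (inj₂ ≤-refl) J₀ , update-≡ (vars s) x)
      ⟫ λ (J₁ , x₁) →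
      tick-step x₁ J₁ refl (λ J₂ x₂ t₂ → J₂ , x₂ , t₂)
      ⟫ λ (J₂ , x₂ , t₂) →
      while-runs n refl J₂ x₂ t₂

  forVec : ℕ → Var → Program → Program
  forVec zero    p P = P
  forVec (suc d) p P = for p (forVec d (suc p) P)

  forVecTime : ℕ → ℕ → ℕ → ℕ
  forVecTime zero    n T = T
  forVecTime (suc d) n T = forTime n (forVecTime d n T)

  -- `Done v` is achieved when the loops reach `v` and must not be undone by the body at other
  -- tuples. This replaces an invariant indexed by the set of tuples visited so far.
  forVec-runs : ∀ d {p} (J : Store → Set) (Done : Vec (Fin n) d → Store → Set) → 6 ≤ p →
    Stable p J → (∀ {v} → Stable p (Done v)) → (∀ {s} → J s → Ready n s) →
    (∀ v {s} → J s → Block s p v →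
      Runs P s T (λ s′ → J s′ × Done v s′ × (∀ u → Done u s → Done u s′) × Block s′ p v)) →
    J s → Runs (forVec d p P) s (forVecTime d n T) (λ s′ → J s′ × (∀ v → Done v s′))
  forVec-runs zero J Done _ _ _ _ body J-s =
    weaken ≤-refl (λ (J′ , D , _) → J′ , λ { [] → D }) (body [] J-s tt)
  forVec-runs {n = n} (suc d) {p} J Done 6≤p J-stable D-stable J-ready body J-s =
    weaken ≤-refl (λ (J′ , D) → J′ , λ { (y ∷ v) → D y (toℕ<n y) v })
      (for-runs p Seen 6≤p
        (λ w (J′ , D) → J-stable w J′ , λ y y<i v → D-stable w (D y y<i v))
        (J-ready ∘ proj₁) outer (J-s , λ _ ()))
    where
    Seen : ℕ → Store → Set
    Seen i s = J s × (∀ y → toℕ y < i → ∀ v → Done (y ∷ v) s)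

    outer : ∀ i {s} → Seen (toℕ i) s → vars s p ≡ toℕ i →
      Runs _ s _ (λ s′ → Seen (suc (toℕ i)) s′ × vars s′ p ≡ toℕ i)
    outer i (J-s , D) pi =
      weaken ≤-refl
        (λ (((J′ , D′) , pi′) , E) → (J′ , λ y y≤i v → new D′ E y v (m<1+n⇒m<n∨m≡n y≤i)) , pi′)
        (forVec-runs d (λ s → Seen (toℕ i) s × vars s p ≡ toℕ i) (λ v → Done (i ∷ v))
          (m≤n⇒m≤1+n 6≤p)
          (λ {y} {k} {s} w ((J′ , D) , pi) →
            ( J-stable (up w) J′ , λ y y<i v → D-stable (up w) (D y y<i v))
            , trans (update-≢ (vars s) (≢p w)) pi)
          (D-stable ∘ up) (J-ready ∘ proj₁ ∘ proj₁)
          (λ v ((J′ , D) , pi) pv → weaken ≤-refl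
            (λ (J″ , Dv , keep , (pi′ , pv′)) →
              ((J″ , λ y y<i v → keep (y ∷ v) (D y y<i v)) , pi′) , Dv , keep ∘ (i ∷_) , pv′)
            (body (i ∷ v) J′ (pi , pv)))
          ((J-s , D) , pi))
      where
      up : ∀ {y} → y ≡ tick ⊎ suc p ≤ y → y ≡ tick ⊎ p ≤ y
      up (inj₁ q) = inj₁ q
      up (inj₂ q) = inj₂ (<⇒≤ q)

      ≢p : ∀ {y} → y ≡ tick ⊎ suc p ≤ y → y ≢ p
      ≢p (inj₁ refl) refl = <⇒≱ 6≤p (s≤s z≤n)
      ≢p (inj₂ p<p) refl = <-irrefl refl p<p

      new : ∀ {s} → (∀ y → toℕ y < toℕ i → ∀ v → Done (y ∷ v) s) → (∀ v → Done (i ∷ v) s) →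
            ∀ y v → toℕ y < toℕ i ⊎ toℕ y ≡ toℕ i → Done (y ∷ v) s
      new D E y v (inj₁ y<i) = D y y<i v
      new D E y v (inj₂ y≡i) with refl ← toℕ-injective y≡i = E v

  -- Formulas over Fin n: a context lists the lengths of the tuples bound so far, innermost first

  Env : ℕ → List ℕ → Set
  Env n Γ = All (Vec (Fin n)) Γ

  Ref : List ℕ → Set
  Ref Γ = ∃[ d ] (d ∈ Γ × Fin d)

  private variable
    Γ Δ : List ℕ

  value : Env n Γ → Ref Γ → Fin n
  value ρ (_ , x , i) = lookup (All.lookup ρ x) i

  select : Env n Γ → All (_∈ Γ) Δ → Env n Δ
  select ρ = All.map (All.lookup ρ)

  -- Tuples are read as numerals in base n. A pair of vertices thus gets the address of its cell in
  -- the row-by-row matrix, and the input needs no conversion to serve as a relation.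
  codeVec : ℕ → Vec (Fin n) d → ℕ
  codeVec         a []      = a
  codeVec {n = n} a (x ∷ v) = codeVec (a * n + toℕ x) v

  code : ℕ → Env n Γ → ℕ
  code a []      = a
  code a (v ∷ ρ) = code (codeVec a v) ρ

  infixr 6 _∧ᶠ_
  infixr 5 _∨ᶠ_

  data Formula (Γ : List ℕ) : Set where
    trueᶠ    : Formula Γ
    diff    : ℕ → Ref Γ → Ref Γ → Formula Γ
    rel     : Arr → All (_∈ Γ) Δ → Formula Γ
    neg     : Formula Γ → Formula Γ
    _∧ᶠ_ _∨ᶠ_ : Formula Γ → Formula Γ → Formula Γ
    ex      : ∀ d → Formula (d ∷ Γ) → Formula Γ

  ⟦_⟧ : Formula Γ → (Arr → ℕ → ℕ) → Env n Γ → Set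
  ⟦ trueᶠ ⟧       M ρ = ⊤
  ⟦ diff k r q ⟧ M ρ = toℕ (value ρ q) ≡ k + toℕ (value ρ r)
  ⟦ rel A xs ⟧   M ρ = M A (code 0 (select ρ xs)) ≢ 0
  ⟦ neg φ ⟧      M ρ = ¬ ⟦ φ ⟧ M ρ
  ⟦ φ ∧ᶠ ψ ⟧      M ρ = ⟦ φ ⟧ M ρ × ⟦ ψ ⟧ M ρ
  ⟦ φ ∨ᶠ ψ ⟧      M ρ = ⟦ φ ⟧ M ρ ⊎ ⟦ ψ ⟧ M ρ
  ⟦ ex d φ ⟧     M ρ = ∃[ v ] ⟦ φ ⟧ M (v ∷ ρ)

  -- The address of a tuple depends only on the tuples bound outside it, so binding another one
  -- moves nothing.
  pos : d ∈ Γ → Var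
  pos {Γ = _ ∷ Γ} (here _)  = base + sum Γ
  pos             (there x) = pos x

  loc : Ref Γ → Var
  loc (_ , x , i) = pos x + toℕ i

  -- Appends a digit to the numeral in `acc`. For want of multiplication, `acc` is added up n times
  -- in `aux`.
  push : Var → Program
  push p =
    aux ≔ const 0 ⨾
    tick ≔ var size ⨾
    whileNZ tick (aux ≔ aux ⊕ acc ⨾ tick ≔ tick ⊖ one) ⨾
    acc ≔ aux ⊕ p

  encodeVec : ℕ → Var → Program
  encodeVec zero    p = skip
  encodeVec (suc d) p = push p ⨾ encodeVec d (suc p)

  encode : All (_∈ Γ) Δ → Program
  encode         []                 = skip
  encode {Δ = d ∷ _} (x ∷ xs) = encodeVec d (pos x) ⨾ encode xs

  test : Formula Γ → Program
  test trueᶠ         = flag ≔ const 1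
  test (diff k r q) =
    aux ≔ const k ⨾
    acc ≔ aux ⊕ loc r ⨾
    -- Subtraction is truncated, so the differences in both directions are added; the sum is 0
    -- exactly in the case of equality.
    tick ≔ acc ⊖ loc q ⨾
    aux ≔ loc q ⊖ acc ⨾
    tick ≔ tick ⊕ aux ⨾
    flag ≔ one ⊖ tick
  test (rel A xs)   = acc ≔ const 0 ⨾ encode xs ⨾ flag ≔ load A acc
  test (neg φ)      = test φ ⨾ ifNZ flag (flag ≔ const 0) (flag ≔ const 1)
  test (φ ∧ᶠ ψ)      = test φ ⨾ ifNZ flag (test ψ) skip
  test (φ ∨ᶠ ψ)      = test φ ⨾ ifNZ flag skip (test ψ)
  test {Γ = Γ} (ex d φ) = flag ≔ const 0 ⨾ forVec d (base + sum Γ) (ifNZ flag skip (test φ))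

  pushTime : ℕ → ℕ
  pushTime n = 1 + (1 + ((1 + n * 3) + 1))

  encodeVecTime : ℕ → ℕ → ℕ
  encodeVecTime zero    n = 1
  encodeVecTime (suc d) n = pushTime n + encodeVecTime d n

  encodeTime : List ℕ → ℕ → ℕ
  encodeTime []      n = 1
  encodeTime (d ∷ Δ) n = encodeVecTime d n + encodeTime Δ n

  time : Formula Γ → ℕ → ℕ
  time trueᶠ         n = 1
  time (diff k r q) n = 6
  time (rel {Δ = Δ} A xs) n = 1 + (encodeTime Δ n + 1)
  time (neg φ)      n = time φ n + (1 + (1 + 1))
  time (φ ∧ᶠ ψ)      n = time φ n + (1 + (time ψ n + 1))
  time (φ ∨ᶠ ψ)      n = time φ n + (1 + (1 + time ψ n))
  time (ex d φ)     n = 1 + forVecTime d n (1 + (1 + time φ n))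

  poly-forTime : IsPoly f → IsPoly (λ n → forTime n (f n))
  poly-forTime F =
    poly-+ (poly-const 1) (poly-+ (poly-const 1) (poly-+ (poly-const 1)
      (poly-* poly-id (poly-+ (poly-const 1) (poly-+ F (poly-const 2))))))

  poly-forVecTime : ∀ d → IsPoly f → IsPoly (λ n → forVecTime d n (f n))
  poly-forVecTime zero    F = F
  poly-forVecTime (suc d) F = poly-forTime (poly-forVecTime d F)

  poly-encodeVecTime : ∀ d → IsPoly (encodeVecTime d)
  poly-encodeVecTime zero    = poly-const 1
  poly-encodeVecTime (suc d) = poly-+
    (poly-+ (poly-const 1) (poly-+ (poly-const 1)
      (poly-+ (poly-+ (poly-const 1) (poly-* poly-id (poly-const 3))) (poly-const 1))))
    (poly-encodeVecTime d)

  poly-encodeTime : ∀ Δ → IsPoly (encodeTime Δ)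
  poly-encodeTime []      = poly-const 1
  poly-encodeTime (d ∷ Δ) = poly-+ (poly-encodeVecTime d) (poly-encodeTime Δ)

  poly-time : (φ : Formula Γ) → IsPoly (time φ)
  poly-time trueᶠ         = poly-const 1
  poly-time (diff k r q) = poly-const 6
  poly-time (rel {Δ = Δ} A xs) = poly-+ (poly-const 1) (poly-+ (poly-encodeTime Δ) (poly-const 1))
  poly-time (neg φ)      = poly-+ (poly-time φ) (poly-const 3)
  poly-time (φ ∧ᶠ ψ)      =
    poly-+ (poly-time φ) (poly-+ (poly-const 1) (poly-+ (poly-time ψ) (poly-const 1)))
  poly-time (φ ∨ᶠ ψ)      = poly-+ (poly-time φ) (poly-+ (poly-const 2) (poly-time ψ))
  poly-time (ex d φ)     =
    poly-+ (poly-const 1) (poly-forVecTime d (poly-+ (poly-const 2) (poly-time φ)))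

  top : List ℕ → Var
  top Γ = base + sum Γ

  Rep : Store → Env n Γ → Set
  Rep             s []      = ⊤
  Rep {Γ = _ ∷ Γ} s (v ∷ ρ) = Block s (top Γ) v × Rep s ρ

  top-∷ : ∀ d Γ → top Γ + d ≤ top (d ∷ Γ)
  top-∷ d Γ = ≤-reflexive (trans (+-assoc base (sum Γ) d) (cong (base +_) (+-comm (sum Γ) d)))

  top-≤ : ∀ d Γ → top Γ ≤ top (d ∷ Γ)
  top-≤ d Γ = ≤-trans (m≤m+n (top Γ) d) (top-∷ d Γ)

  6≤base+ : ∀ k → 6 ≤ base + k
  6≤base+ k = ≤-trans (m≤m+n 6 2) (m≤m+n base k)

  4≤base+ : ∀ k → 4 ≤ base + k
  4≤base+ k = ≤-trans (m≤m+n 4 2) (6≤base+ k)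

  Rep-frame : (ρ : Env n Γ) → Frame (top Γ) s s′ → Rep s ρ → Rep s′ ρ
  Rep-frame             []      F _          = tt
  Rep-frame {Γ = d ∷ Γ} (v ∷ ρ) F (sv , sρ) =
    Block-frame v (4≤base+ (sum Γ)) (top-∷ d Γ) F sv , Rep-frame ρ (Frame-≤ (top-≤ d Γ) F) sρ

  Rep-block : (ρ : Env n Γ) → Rep s ρ → (x : d ∈ Γ) → Block s (pos x) (All.lookup ρ x)
  Rep-block (v ∷ ρ) (sv , _)  (here refl) = sv
  Rep-block (v ∷ ρ) (_  , sρ) (there x)   = Rep-block ρ sρ x

  4≤pos : (x : d ∈ Γ) → 4 ≤ pos x
  4≤pos {Γ = _ ∷ Γ} (here _)  = 4≤base+ (sum Γ)
  4≤pos             (there x) = 4≤pos x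

  pos-top : (x : d ∈ Γ) → pos x + d ≤ top Γ
  pos-top {d} {_ ∷ Γ} (here refl) = top-∷ d Γ
  pos-top {d} {d′ ∷ Γ} (there x)  = ≤-trans (pos-top x) (top-≤ d′ Γ)

  module _ {n b : ℕ} (6≤b : 6 ≤ b) where

    private
      while-acc : ∀ k {s} → vars s tick ≡ k → vars s one ≡ 1 →
        Runs (whileNZ tick (aux ≔ aux ⊕ acc ⨾ tick ≔ tick ⊖ one)) s (1 + k * 3)
          (λ s′ → Frame b s s′ × vars s′ acc ≡ vars s acc ×
                  vars s′ aux ≡ vars s aux + k * vars s acc)
      while-acc zero {s} t≡0 _ =
        1 , _ , exit⇓ t≡0 , ≤-refl , Frame-refl , refl , sym (+-identityʳ _)
      while-acc (suc k) {s} t≡ o≡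
        with while-acc k {assign tick (vars s tick ∸ vars s one)
                           (assign aux (vars s aux + vars s acc) s)}
               (cong₂ _∸_ t≡ o≡) o≡
      ... | t , s′ , run , t≤ , F , a , x =
        1 + 2 + t , s′ ,
        loop⇓ (λ z → 1+n≢0 (trans (sym t≡) z)) (seq⇓ assign⇓ assign⇓) run ,
        s≤s (s≤s (s≤s (t≤))) ,
        Frame-trans (Frame-trans (Frame-assign (inj₁ ≤-refl))
                                 (Frame-assign (inj₁ (s≤s (s≤s z≤n))))) F ,
        a , trans x (+-assoc (vars s aux) (vars s acc) _)

    push-runs : ∀ {p s} → Ready n s → 4 ≤ p → p < b →
      Runs (push p) s (pushTime n)
        (λ s′ → Frame b s s′ × vars s′ acc ≡ vars s acc * n + vars s p)
    push-runs {p} {s} R 4≤p p<b =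
      assigned {Φ = λ s₁ → Frame b s s₁ × vars s₁ acc ≡ vars s acc × vars s₁ aux ≡ 0}
        (Frame-assign (inj₁ ≤-refl) , refl , refl)
      ⟫ λ {s₁} (F₁ , a₁ , x₁) →
      assigned
        {Φ = λ s₂ → Frame b s s₂ × vars s₂ acc ≡ vars s acc × vars s₂ aux ≡ 0 × vars s₂ tick ≡ n}
        ( Frame-trans F₁ (Frame-assign (inj₁ (s≤s (s≤s z≤n)))) , a₁ , x₁
        , size≡ (Ready-frame 6≤b F₁ R))
      ⟫ λ {s₂} (F₂ , a₂ , x₂ , t₂) →
      weaken ≤-refl (λ (F₃ , _ , x₃) →
          Frame-trans F₂ F₃ , trans x₃ (trans (cong (_+ n * vars s₂ acc) x₂) (cong (n *_) a₂)))
        (while-acc n t₂ (one≡ (Ready-frame 6≤b F₂ R)))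
      ⟫ λ {s₃} (F₃ , x₃) →
      assigned (Frame-trans F₃ (Frame-assign (inj₁ (s≤s (s≤s (s≤s z≤n)))))
        , cong₂ _+_ (trans x₃ (*-comm n (vars s acc))) (kept F₃ 4≤p p<b))

    encodeVec-runs : ∀ {d p s} → Ready n s → 4 ≤ p → p + d ≤ b → (v : Vec (Fin n) d) → Block s p v →
      Runs (encodeVec d p) s (encodeVecTime d n)
        (λ s′ → Frame b s s′ × vars s′ acc ≡ codeVec (vars s acc) v)
    encodeVec-runs R _ _ [] _ = assigned (Frame-assign (inj₁ (s≤s (s≤s z≤n))) , refl)
    encodeVec-runs {suc d} {p} {s} R 4≤p p+d≤b (x ∷ v) (px , pv) =
      push-runs R 4≤p p<b
      ⟫ λ {s₁} (F , a) →
      weaken ≤-refl (λ (F′ , a′) → Frame-trans F F′ ,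
          trans a′ (cong (λ a → codeVec a v) (trans a (cong (vars s acc * n +_) px))))
        (encodeVec-runs (Ready-frame 6≤b F R) (m≤n⇒m≤1+n 4≤p) p′
          v (Block-frame v (m≤n⇒m≤1+n 4≤p) p′ F pv))
      where
      p<b : p < b
      p<b = <-≤-trans (m<m+n p (s≤s z≤n)) p+d≤b

      p′ : suc p + d ≤ b
      p′ = ≤-trans (≤-reflexive (sym (+-suc p d))) p+d≤b

  encode-runs : (xs : All (_∈ Γ) Δ) (ρ : Env n Γ) → Ready n s → Rep s ρ →
    Runs (encode xs) s (encodeTime Δ n)
      (λ s′ → Frame (top Γ) s s′ × vars s′ acc ≡ code (vars s acc) (select ρ xs))
  encode-runs [] ρ R sρ = assigned (Frame-assign (inj₁ (s≤s (s≤s z≤n))) , refl)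
  encode-runs {Γ = Γ} (x ∷ xs) ρ R sρ =
    encodeVec-runs (6≤base+ (sum Γ)) R (4≤pos x) (pos-top x) _ (Rep-block ρ sρ x)
    ⟫ λ (F , a) →
    weaken ≤-refl (λ (F′ , a′) → Frame-trans F F′ , trans a′ (cong (λ a → code a (select ρ xs)) a))
      (encode-runs xs ρ (Ready-frame (6≤base+ (sum Γ)) F R) (Rep-frame ρ F sρ))


  Decides : Store → Set → Set
  Decides s A = vars s flag ≢ 0 ⇔ A

  private
    ≡⇒1∸≢0 : ∀ m k → k ≡ m → 1 ∸ ((m ∸ k) + (k ∸ m)) ≢ 0
    ≡⇒1∸≢0 m .m refl rewrite n∸n≡0 m = λ ()

    1∸≢0⇒≡ : ∀ m k → 1 ∸ ((m ∸ k) + (k ∸ m)) ≢ 0 → k ≡ m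
    1∸≢0⇒≡ m k ≢0 with (m ∸ k) + (k ∸ m) in eq
    ... | suc z = ⊥-elim (≢0 (0∸n≡0 z))
    ... | zero  = ≤-antisym (m∸n≡0⇒m≤n (m+n≡0⇒n≡0 (m ∸ k) eq)) (m∸n≡0⇒m≤n (m+n≡0⇒m≡0 (m ∸ k) eq))

    diff-runs : ∀ k {x y} → 4 ≤ x → 4 ≤ y → vars s one ≡ 1 →
      Runs (aux ≔ const k ⨾ acc ≔ aux ⊕ x ⨾ tick ≔ acc ⊖ y ⨾ aux ≔ y ⊖ acc ⨾
            tick ≔ tick ⊕ aux ⨾ flag ≔ one ⊖ tick) s 6
        (λ s′ → Frame b s s′ × Decides s′ (vars s y ≡ k + vars s x))
    diff-runs {s} k {x} {y} (s≤s (s≤s (s≤s (s≤s _)))) (s≤s (s≤s (s≤s (s≤s _)))) one≡1 =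
      6 , _ ,
      seq⇓ assign⇓ (seq⇓ assign⇓ (seq⇓ assign⇓ (seq⇓ assign⇓ (seq⇓ assign⇓ assign⇓)))) ,
      ≤-refl ,
      frame refl (λ { (s≤s (s≤s (s≤s (s≤s _)))) _ → refl }) ,
      mk⇔ (λ ≢0 → 1∸≢0⇒≡ m (vars s y) (≢0 ∘ trans (cong (_∸ gap) one≡1)))
          (λ eq z → ≡⇒1∸≢0 m (vars s y) eq (trans (cong (_∸ gap) (sym one≡1)) z))
      where
      m = k + vars s x
      gap = (m ∸ vars s y) + (vars s y ∸ m)

  -- Truth refers to the arrays of the initial store throughout. A test writes only to scratch
  -- variables and from `top Γ` on, so arrays and bound tuples are unchanged when the next
  -- subformula is tested.
  test-runs : (φ : Formula Γ) (ρ : Env n Γ) → Ready n s → Rep s ρ →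
    Runs (test φ) s (time φ n)
      (λ s′ → Frame (top Γ) s s′ × Decides s′ (⟦ φ ⟧ (arrays s) ρ))
  test-runs trueᶠ ρ R sρ = assigned (Frame-assign (inj₁ (s≤s z≤n)) , mk⇔ (λ _ → tt) (λ _ ()))
  test-runs (diff k r@(_ , x , i) q@(_ , y , j)) ρ R sρ =
    weaken ≤-refl
      (λ (F , D) → F , mk⇔ (λ f → trans (sym qv) (trans (to D f) (cong (k +_) rv)))
                           (λ e → from D (trans qv (trans e (cong (k +_) (sym rv))))))
      (diff-runs k (≤-trans (4≤pos x) (m≤m+n _ _)) (≤-trans (4≤pos y) (m≤m+n _ _)) (one≡ R))
    where
    rv = Block-lookup (All.lookup ρ x) (Rep-block ρ sρ x) i
    qv = Block-lookup (All.lookup ρ y) (Rep-block ρ sρ y) j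
  test-runs {Γ = Γ} {s = s} (rel A xs) ρ R sρ =
    assigned {Φ = λ s₁ → Frame (top Γ) s s₁ × vars s₁ acc ≡ 0}
      (Frame-assign (inj₁ (s≤s (s≤s (s≤s z≤n)))) , refl)
    ⟫ λ (F , a) →
    encode-runs xs ρ (Ready-frame (6≤base+ (sum Γ)) F R) (Rep-frame ρ F sρ)
    ⟫ λ {s₂} (F′ , a′) →
    let G  = Frame-trans F F′
        eq = cong₂ (λ M a → M A a) (mem G) (trans a′ (cong (λ a → code a (select ρ xs)) a))
    in assigned (Frame-trans G (Frame-assign (inj₁ (s≤s z≤n))) ,
                 mk⇔ (λ ≢0 → ≢0 ∘ trans eq) (λ ≢0 → ≢0 ∘ trans (sym eq)))
  test-runs (neg φ) ρ R sρ =
    test-runs φ ρ R sρ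
    ⟫ λ (F , D) →
    branch
      (λ ≢0 → assigned (Frame-trans F (Frame-assign (inj₁ (s≤s z≤n))) ,
                mk⇔ (λ f → ⊥-elim (f refl)) (λ ¬φ → ⊥-elim (¬φ (to D ≢0)))))
      (λ ≡0 → assigned (Frame-trans F (Frame-assign (inj₁ (s≤s z≤n))) ,
                mk⇔ (λ _ φ → from D φ ≡0) (λ _ ())))
  test-runs {Γ = Γ} (φ ∧ᶠ ψ) ρ R sρ =
    test-runs φ ρ R sρ
    ⟫ λ (F , D) →
    branch
      (λ ≢0 → weaken ≤-refl
        (λ (F′ , D′) → Frame-trans F F′ ,
          mk⇔ (λ f → to D ≢0 , subst (λ M → ⟦ ψ ⟧ M ρ) (mem F) (to D′ f))
              (λ (_ , q) → from D′ (subst (λ M → ⟦ ψ ⟧ M ρ) (sym (mem F)) q)))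
        (test-runs ψ ρ (Ready-frame (6≤base+ (sum Γ)) F R) (Rep-frame ρ F sρ)))
      (λ ≡0 → assigned (Frame-trans F (Frame-assign (inj₁ (s≤s (s≤s z≤n)))) ,
        mk⇔ (λ f → ⊥-elim (f ≡0)) (λ (p , _) → from D p)))
  test-runs {Γ = Γ} (φ ∨ᶠ ψ) ρ R sρ =
    test-runs φ ρ R sρ
    ⟫ λ (F , D) →
    branch
      (λ ≢0 → assigned (Frame-trans F (Frame-assign (inj₁ (s≤s (s≤s z≤n)))) ,
        mk⇔ (inj₁ ∘ to D) (λ _ → ≢0)))
      (λ ≡0 → weaken ≤-refl
        (λ (F′ , D′) → Frame-trans F F′ ,
          mk⇔ (λ f → inj₂ (subst (λ M → ⟦ ψ ⟧ M ρ) (mem F) (to D′ f)))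
              (λ { (inj₁ p) → ⊥-elim (from D p ≡0)
                 ; (inj₂ q) → from D′ (subst (λ M → ⟦ ψ ⟧ M ρ) (sym (mem F)) q) }))
        (test-runs ψ ρ (Ready-frame (6≤base+ (sum Γ)) F R) (Rep-frame ρ F sρ)))
  test-runs {Γ = Γ} {n = n} {s = s} (ex d φ) ρ R sρ =
    assigned {Φ = λ s₁ → Frame (top Γ) s s₁ × vars s₁ flag ≡ 0}
      (Frame-assign (inj₁ (s≤s z≤n)) , refl)
    ⟫ λ (F , f) →
    weaken ≤-refl
      (λ ((F , w) , D) → F , mk⇔ w (λ (v , p) → D v p))
      (forVec-runs d Inv Done (6≤base+ (sum Γ))
        (λ {_} {k} {s} w (F , p) →
          Frame-trans F (Frame-assign (scratch w)) , λ f → p (f ∘ trans (unflagged {k = k} {s} w)))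
        (λ {_} {_} {k} {s} w D p f → D p (trans (sym (unflagged {k = k} {s} w)) f))
        (λ (F , _) → Ready-frame (6≤base+ (sum Γ)) F R)
        body (F , λ ≢0 → ⊥-elim (≢0 f)))
    where
    -- `Inv` says that a raised flag has a witness, `Done` that a witness already visited has raised
    -- the flag; together they make the flag decide the existential formula.
    Inv : Store → Set
    Inv s₁ = Frame (top Γ) s s₁ × (vars s₁ flag ≢ 0 → ∃[ v ] ⟦ φ ⟧ (arrays s) (v ∷ ρ))

    Done : Vec (Fin n) d → Store → Set
    Done v s₁ = ⟦ φ ⟧ (arrays s) (v ∷ ρ) → vars s₁ flag ≢ 0

    scratch : y ≡ tick ⊎ top Γ ≤ y → y < 4 ⊎ top Γ ≤ y
    scratch (inj₁ refl) = inj₁ (s≤s (s≤s z≤n))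
    scratch (inj₂ q)    = inj₂ q

    unflagged : ∀ {y k s} → y ≡ tick ⊎ top Γ ≤ y → vars (assign y k s) flag ≡ vars s flag
    unflagged                 (inj₁ refl) = refl
    unflagged {zero}          (inj₂ ())
    unflagged {suc y} {s = s} (inj₂ _)    = refl

    body : ∀ v {s₁} → Inv s₁ → Block s₁ (top Γ) v →
      Runs (ifNZ flag skip (test φ)) s₁ _
        (λ s₂ → Inv s₂ × Done v s₂ × (∀ u → Done u s₁ → Done u s₂) × Block s₂ (top Γ) v)
    body v {s₁} (F , p) sv = branch
      (λ ≢0 → assigned
        ( (Frame-trans F (Frame-assign (inj₁ (s≤s (s≤s z≤n)))) , p) , (λ _ → ≢0) , (λ _ _ _ → ≢0)
        , Block-frame v (4≤base+ (sum Γ)) ≤-refl (Frame-assign (inj₁ (s≤s (s≤s z≤n)))) sv))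
      (λ ≡0 → weaken ≤-refl
        (λ (F′ , D) →
          ( Frame-trans F (Frame-≤ (top-≤ d Γ) F′)
          , λ f → v , subst (λ M → ⟦ φ ⟧ M (v ∷ ρ)) (mem F) (to D f))
          , (λ q → from D (subst (λ M → ⟦ φ ⟧ M (v ∷ ρ)) (sym (mem F)) q))
          , (λ u old q → ⊥-elim (old q ≡0))
          , Block-frame v (4≤base+ (sum Γ)) (top-∷ d Γ) F′ sv)
        (test-runs φ (v ∷ ρ) (Ready-frame (6≤base+ (sum Γ)) F R) (sv , Rep-frame ρ F sρ)))

  -- Inflationary fixed points

  -- The last digit is the remainder modulo n. The accumulators vary so that the induction can strip
  -- digits from that end. Injectivity guarantees that writing one entry of the table creates no
  -- other.
  codeVec-injective : ∀ {a b} (v w : Vec (Fin n) d) → codeVec a v ≡ codeVec b w → a ≡ b × v ≡ w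
  codeVec-injective []      []      eq = eq , refl
  codeVec-injective {n = n@(suc _)} {a = a} {b} (x ∷ v) (y ∷ w) eq
    with codeVec-injective v w eq
  ... | eq′ , refl = *-cancelʳ-≡ a b n (+-cancelʳ-≡ (toℕ y) (a * n) (b * n)
                       (subst (λ x → a * n + toℕ x ≡ b * n + toℕ y) x≡y eq′))
                   , cong (_∷ v) x≡y
    where
    rem : ∀ a (x : Fin n) → (a * n + toℕ x) % n ≡ toℕ x
    rem a x = trans (cong (_% n) (+-comm (a * n) (toℕ x)))
                (trans ([m+kn]%n≡m%n (toℕ x) a n) (m<n⇒m%n≡m (toℕ<n x)))

    x≡y : x ≡ y
    x≡y = toℕ-injective (trans (sym (rem a x)) (trans (cong (_% n) eq′) (rem b y)))

  code-injective : ∀ {a b} (ρ σ : Env n Γ) → code a ρ ≡ code b σ → a ≡ b × ρ ≡ σ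
  code-injective []      []      eq = eq , refl
  code-injective (v ∷ ρ) (w ∷ σ) eq with code-injective ρ σ eq
  ... | eq′ , refl with codeVec-injective v w eq′
  ...   | eq″ , refl = eq″ , refl

  select-tabulate : (ρ : Env n Γ) (σ : Env n Δ) (f : ∀ {d} → d ∈ Δ → d ∈ Γ) →
    (∀ {d} (x : d ∈ Δ) → All.lookup ρ (f x) ≡ All.lookup σ x) → select ρ (All.tabulate f) ≡ σ
  select-tabulate ρ []      f eq = refl
  select-tabulate ρ (v ∷ σ) f eq =
    cong₂ _∷_ (eq (here refl)) (select-tabulate ρ σ (f ∘ there) (eq ∘ there))

  forEnv : List ℕ → Program → Program
  forEnv []      P = P
  forEnv (d ∷ Δ) P = forEnv Δ (forVec d (top Δ) P)

  forEnvTime : List ℕ → ℕ → ℕ → ℕ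
  forEnvTime []      n T = T
  forEnvTime (d ∷ Δ) n T = forEnvTime Δ n (forVecTime d n T)

  poly-forEnvTime : ∀ Δ → IsPoly f → IsPoly (λ n → forEnvTime Δ n (f n))
  poly-forEnvTime []      F = F
  poly-forEnvTime (d ∷ Δ) F = poly-forEnvTime Δ (poly-forVecTime d F)

  forEnv-runs : ∀ Δ (J : Store → Set) (Done : Env n Δ → Store → Set) →
    Stable base J → (∀ {ρ} → Stable base (Done ρ)) → (∀ {s} → J s → Ready n s) →
    (∀ ρ {s} → J s → Rep s ρ →
      Runs P s T (λ s′ → J s′ × Done ρ s′ × (∀ σ → Done σ s → Done σ s′) × Rep s′ ρ)) →
    J s → Runs (forEnv Δ P) s (forEnvTime Δ n T) (λ s′ → J s′ × (∀ ρ → Done ρ s′))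
  forEnv-runs [] J Done _ _ _ body J-s =
    weaken ≤-refl (λ (J′ , D , _) → J′ , λ { [] → D }) (body [] J-s tt)
  forEnv-runs {n = n} (d ∷ Δ) J Done J-stable D-stable J-ready body J-s =
    weaken ≤-refl (λ (J′ , D) → J′ , λ { (v ∷ ρ) → D ρ v })
      (forEnv-runs Δ J (λ ρ s → ∀ v → Done (v ∷ ρ) s) J-stable (λ w D v → D-stable w (D v)) J-ready
        (λ ρ {s} J′ sρ → weaken ≤-refl
          (λ ((J″ , sρ′ , old) , D) → J″ , D , (λ σ D′ v → old (v ∷ σ) (D′ v)) , sρ′)
          (forVec-runs d (λ s₁ → J s₁ × Rep s₁ ρ × (∀ σ → Done σ s → Done σ s₁))
            (λ v → Done (v ∷ ρ)) (6≤base+ (sum Δ))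
            (λ w (J₁ , sρ₁ , old) →
              J-stable (low w) J₁ , Rep-frame ρ (Frame-assign (scratch w)) sρ₁ ,
              λ σ D → D-stable (low w) (old σ D))
            (D-stable ∘ low) (J-ready ∘ proj₁)
            (λ v (J₁ , sρ₁ , old) sv → weaken ≤-refl
              (λ (J₂ , D , keep , sv₂ , sρ₂) →
                (J₂ , sρ₂ , λ σ D′ → keep σ (old σ D′)) , D , (λ u → keep (u ∷ ρ)) , sv₂)
              (body (v ∷ ρ) J₁ (sv , sρ₁)))
            (J′ , sρ , λ σ D → D)))
        J-s)
    where
    low : y ≡ tick ⊎ top Δ ≤ y → y ≡ tick ⊎ base ≤ y
    low (inj₁ q) = inj₁ q
    low (inj₂ q) = inj₂ (≤-trans (m≤m+n base (sum Δ)) q)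

    scratch : y ≡ tick ⊎ top Δ ≤ y → y < 4 ⊎ top Δ ≤ y
    scratch (inj₁ refl) = inj₁ (s≤s (s≤s z≤n))
    scratch (inj₂ q)    = inj₂ q

  Block-vars : ∀ {p} (v : Vec (Fin n) d) → vars s′ ≡ vars s → Block s p v → Block s′ p v
  Block-vars         []      _  _         = tt
  Block-vars {p = p} (x ∷ v) eq (px , pv) = trans (cong (λ h → h p) eq) px , Block-vars v eq pv

  Rep-vars : (ρ : Env n Γ) → vars s′ ≡ vars s → Rep s ρ → Rep s′ ρ
  Rep-vars []      _  _         = tt
  Rep-vars (v ∷ ρ) eq (sv , sρ) = Block-vars v eq sv , Rep-vars ρ eq sρ

  module Fixpoint (Δ : List ℕ) (step : Formula Δ) (final : Formula []) where

    same : All (_∈ Δ) Δ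
    same = All.tabulate id

    -- Entries are made in place, so later tests of the same sweep may already see them. This does
    -- no harm: `Table` demands only that all entries are sound and that enough of them are present.
    visit : Program
    visit = test step ⨾ ifNZ flag (acc ≔ const 0 ⨾ encode same ⨾ 1 [ acc ]≔ one) skip

    sweeps : Program
    sweeps = for 6 (for 7 (forEnv Δ visit))

    program : Program
    program = size ≔ var flag ⨾ one ≔ const 1 ⨾ sweeps ⨾ test final

    visitTime : ℕ → ℕ
    visitTime n = time step n + (1 + ((1 + (encodeTime Δ n + 1)) + 1))

    programTime : ℕ → ℕ
    programTime n =
      1 + (1 + (forTime n (forTime n (forEnvTime Δ n (visitTime n))) + time final n))

    poly-programTime : IsPoly programTime
    poly-programTime =
      poly-+ (poly-const 2) (poly-+
        (poly-forTime (poly-forTime (poly-forEnvTime Δ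
          (poly-+ (poly-time step) (poly-+ (poly-const 1)
            (poly-+ (poly-+ (poly-const 1) (poly-+ (poly-encodeTime Δ) (poly-const 1)))
              (poly-const 1)))))))
        (poly-time final))

    module _ {n : ℕ} (M₀ : ℕ → ℕ) (Sound : Env n Δ → Set) (Reach : ℕ → ℕ → Env n Δ → Set) where

      Entry : (Arr → ℕ → ℕ) → Env n Δ → Set
      Entry M ρ = M 1 (code 0 ρ) ≢ 0

      -- The contents are never described exactly. They are held between a lower bound `Reach` and
      -- an upper bound `Sound`, neither of which has to be decided.
      record Table (i j : ℕ) (M : Arr → ℕ → ℕ) : Set where
        constructor table
        field
          base≡   : M 0 ≡ M₀
          sound   : ∀ ρ → Entry M ρ → Sound ρ
          reached : ∀ ρ → Reach i j ρ → Entry M ρ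

      open Table

      module _ (closed : ∀ {M} → M 0 ≡ M₀ → (∀ ρ → Entry M ρ → Sound ρ) →
                  ∀ ρ → ⟦ step ⟧ M ρ → Sound ρ)
               (start : ∀ ρ → ¬ Reach 0 0 ρ)
               (progress : ∀ {M} (i j : Fin n) → M 0 ≡ M₀ →
                  (∀ ρ → Reach (toℕ i) (toℕ j) ρ → Entry M ρ) →
                  ∀ ρ → Reach (toℕ i) (suc (toℕ j)) ρ → ⟦ step ⟧ M ρ)
               (turn : ∀ i ρ → Reach (suc i) 0 ρ → Reach i n ρ) where

        private
          Inv : ℕ → ℕ → Store → Set
          Inv i j s = Ready n s × Table i j (arrays s)

          Ready-assign : ∀ {y k s} → y ≡ tick ⊎ 6 ≤ y → Ready n s → Ready n (assign y k s)
          Ready-assign (inj₁ refl) = Ready-frame ≤-refl (Frame-assign (inj₁ (s≤s (s≤s z≤n))))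
          Ready-assign (inj₂ q)    = Ready-frame ≤-refl (Frame-assign (inj₂ q))

          At : ℕ → ℕ → Store → Set
          At i j s = vars s 6 ≡ i × vars s 7 ≡ j

          At-frame : base ≤ b → Frame b s s′ → At i j s → At i j s′
          At-frame 8≤b F (p , q) =
            trans (kept F (m≤m+n 4 2) (≤-trans (m≤m+n 7 1) 8≤b)) p ,
            trans (kept F (m≤m+n 4 3) 8≤b) q

          module _ (i j : Fin n) where

            Now : Store → Set
            Now s = Inv (toℕ i) (toℕ j) s × At (toℕ i) (toℕ j) s

            Done : Env n Δ → Store → Set
            Done ρ s = Reach (toℕ i) (suc (toℕ j)) ρ → Entry (arrays s) ρ

            base≤top : base ≤ top Δ
            base≤top = m≤m+n base (sum Δ)

            Now-frame : Frame (top Δ) s s′ → Now s → Now s′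
            Now-frame F ((R , t) , at) =
              (Ready-frame (6≤base+ (sum Δ)) F R , subst (Table _ _) (sym (mem F)) t) ,
              At-frame base≤top F at

            module _ (ρ : Env n Δ) (s : Store) (R : Ready n s)
                     (t : Table (toℕ i) (toℕ j) (arrays s))
                     (at : At (toℕ i) (toℕ j) s) (sρ : Rep s ρ) where

              Result : Store → Set
              Result s′ = Now s′ × Done ρ s′ × (∀ σ → Done σ s → Done σ s′) × Rep s′ ρ

              unchanged : Frame (top Δ) s s′ → ¬ ⟦ step ⟧ (arrays s) ρ → Result s′
              unchanged F ¬step =
                Now-frame F ((R , t) , at) ,
                (λ r → ⊥-elim (¬step (progress i j (base≡ t) (reached t) ρ r))) ,
                (λ σ D r → subst (λ M → Entry M σ) (sym (mem F)) (D r)) ,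
                Rep-frame ρ F sρ

              entered : Frame (top Δ) s s′ → vars s′ acc ≡ code 0 ρ → ⟦ step ⟧ (arrays s) ρ →
                Result (store 1 (vars s′ acc) (vars s′ one) s′)
              entered {s′} F a holds =
                ( ( ready (size≡ R′) (one≡ R′)
                  , table (trans (cong (λ M → M 0) (mem F)) (base≡ t)) sound′
                      (λ σ r → grow σ (reached t σ r)))
                , At-frame base≤top F at)
                , (λ _ → new)
                , (λ σ D r → grow σ (D r))
                , Rep-vars ρ refl (Rep-frame ρ F sρ)
                where
                R′ = Ready-frame (6≤base+ (sum Δ)) F R
                s″ = store 1 (vars s′ acc) (vars s′ one) s′

                new : Entry (arrays s″) ρ
                new z = 1+n≢0 (trans (sym (one≡ R′)) (trans (sym
                  (trans (cong (arrays s″ 1) (sym a)) (update-≡ (arrays s′ 1) (vars s′ acc)))) z))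

                grow : ∀ σ → Entry (arrays s) σ → Entry (arrays s″) σ
                grow σ old with vars s′ acc ≟ code 0 σ
                ... | yes eq with refl ← proj₂ (code-injective ρ σ (trans (sym a) eq)) = new
                ... | no ne  = λ z → old (trans (cong (λ M → M 1 (code 0 σ)) (sym (mem F)))
                                 (trans (sym (update-≢ (arrays s′ 1) ne)) z))

                sound′ : ∀ σ → Entry (arrays s″) σ → Sound σ
                sound′ σ e with vars s′ acc ≟ code 0 σ
                ... | yes eq with refl ← proj₂ (code-injective ρ σ (trans (sym a) eq)) =
                  closed (base≡ t) (sound t) ρ holds
                ... | no ne  = sound t σ λ z → e (trans (update-≢ (arrays s′ 1) ne)
                                 (trans (cong (λ M → M 1 (code 0 σ)) (mem F)) z))

              visit-runs : Runs visit s (visitTime n) Result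
              visit-runs =
                test-runs step ρ R sρ
                ⟫ λ {s₁} (F , D) →
                branch
                  (λ ≢0 →
                    assigned {Φ = λ s₂ → Frame (top Δ) s s₂ × vars s₂ acc ≡ 0}
                      (Frame-trans F (Frame-assign (inj₁ (s≤s (s≤s (s≤s z≤n))))) , refl)
                    ⟫ λ (F₂ , a₂) →
                    encode-runs same ρ (Ready-frame (6≤base+ (sum Δ)) F₂ R) (Rep-frame ρ F₂ sρ)
                    ⟫ λ {s₃} (F₃ , a₃) →
                    stored (entered (Frame-trans F₂ F₃)
                      (trans a₃ (cong₂ code a₂ (select-tabulate ρ ρ id λ _ → refl)))
                      (to D ≢0)))
                  (λ ≡0 → assigned (unchanged
                    (Frame-trans F (Frame-assign (inj₁ (s≤s (s≤s z≤n))))) (λ h → from D h ≡0)))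

            sweep-runs : Now s → Runs (forEnv Δ visit) s (forEnvTime Δ n (visitTime n))
              (λ s′ → Inv (toℕ i) (suc (toℕ j)) s′ × At (toℕ i) (toℕ j) s′)
            sweep-runs now = weaken ≤-refl
              (λ (((R , t) , at) , D) → (R , table (base≡ t) (sound t) D) , at)
              (forEnv-runs Δ Now Done
                (λ {_} {k} {s} w ((R , t) , at) →
                  (Ready-assign (up w) R , t) ,
                  At-frame ≤-refl (Frame-assign {s = s} {k = k} (scratch w)) at)
                (λ _ D → D) (proj₁ ∘ proj₁)
                (λ ρ {s} ((R , t) , at) sρ → visit-runs ρ s R t at sρ)
                now)
              where
              up : y ≡ tick ⊎ base ≤ y → y ≡ tick ⊎ 6 ≤ y
              up (inj₁ q) = inj₁ q
              up (inj₂ q) = inj₂ (≤-trans (m≤m+n 6 2) q)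

              scratch : y ≡ tick ⊎ base ≤ y → y < 4 ⊎ base ≤ y
              scratch (inj₁ refl) = inj₁ (s≤s (s≤s z≤n))
              scratch (inj₂ q)    = inj₂ q

          sweeps-run : Inv 0 0 s →
            Runs sweeps s (forTime n (forTime n (forEnvTime Δ n (visitTime n)))) (Inv n 0)
          sweeps-run I = for-runs 6 (λ i → Inv i 0) ≤-refl
            (λ w (R , t) → Ready-assign w R , t) proj₁
            (λ i {s} I p → weaken ≤-refl
              (λ ((R , t) , q) →
                (R , table (base≡ t) (sound t) (λ ρ → reached t ρ ∘ turn (toℕ i) ρ)) , q)
              (for-runs 7 (λ j s → Inv (toℕ i) j s × vars s 6 ≡ toℕ i) (n≤1+n 6)
                (λ { (inj₁ refl) ((R , t) , q) → (Ready-assign (inj₁ refl) R , t) , q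
                   ; {s = s} (inj₂ 7≤y) ((R , t) , q) →
                       (Ready-assign (inj₂ (<⇒≤ 7≤y)) R , t)
                       , trans (update-≢ (vars s) (≢-sym (<⇒≢ 7≤y))) q })
                (proj₁ ∘ proj₁)
                (λ j (I , q) r → weaken ≤-refl
                  (λ (I′ , q′ , r′) → (I′ , q′) , r′) (sweep-runs i j (I , q , r)))
                (I , p)))
            I

        program-runs : vars s 0 ≡ n → arrays s 0 ≡ M₀ → (∀ k → arrays s 1 k ≡ 0) →
          Runs program s (programTime n)
            (λ s′ → ∃[ M ] (Table n 0 M × Decides s′ (⟦ final ⟧ M (All.[] {P = Vec (Fin n)}))))
        program-runs {s} n≡ m₀ m₁ =
          assigned {Φ = λ s₁ → vars s₁ size ≡ n × arrays s₁ ≡ arrays s} (n≡ , refl)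
          ⟫ λ {s₁} (n₁ , e₁) →
          assigned {Φ = λ s₂ → Ready n s₂ × arrays s₂ ≡ arrays s} (ready n₁ refl , e₁)
          ⟫ λ { {s₂} (R , refl) →
          sweeps-run
            (R , table m₀ (λ ρ e → ⊥-elim (e (m₁ (code 0 ρ)))) (λ ρ r → ⊥-elim (start ρ r)))
          ⟫ λ {s₃} (R₃ , t) →
          weaken ≤-refl (λ (_ , D) → arrays s₃ , t , D) (test-runs final [] R₃ tt) }

open Machine
open import Data.Bool.Base using (T)

private variable
  b d n : ℕ
  Γ Δ : List ℕ
  f f′ : Fin n → Bool

-- Growing a tree from a root

unique-length : (xs : List (Fin n)) → Unique xs → length xs ≤ n
unique-length xs uniq = Finₚ.injective⇒≤ (injective xs uniq)
  where
  injective : ∀ (xs : List (Fin n)) → Unique xs →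
    ∀ {i j} → List.lookup xs i ≡ List.lookup xs j → i ≡ j
  injective (x ∷ xs) (x∉ ∷ u) {zero}  {zero}  eq = refl
  injective (x ∷ xs) (x∉ ∷ u) {zero}  {suc j} eq = ⊥-elim (All.lookup x∉ (∈-lookup j) eq)
  injective (x ∷ xs) (x∉ ∷ u) {suc i} {zero}  eq = ⊥-elim (All.lookup x∉ (∈-lookup i) (sym eq))
  injective (x ∷ xs) (x∉ ∷ u) {suc i} {suc j} eq = cong suc (injective xs u eq)

module Rooted {n : ℕ} (G : Graph n) (r : Fin n) where
  open Graph G using (_~_)
  open EdgeSet (edges G) using () renaming (sym to ~-sym; irrefl to ~-irrefl)
  open DecMembership (Finₚ._≟_ {n}) using (_∈?_)

  -- A new vertex has exactly one neighbour among the earlier ones, its parent. Its other neighbours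
  -- come later, so the time of addition can play the role of depth.
  data Growth : List (Fin n) → Set where
    seed : Growth (r ∷ [])
    grow : ∀ {S x p} → Growth S → x ∉ S → p ∈ S → p ~ x →
           (∀ {y} → y ∈ S → y ~ x → y ≡ p) → Growth (x ∷ S)

  private variable
    S : List (Fin n)
    u v w x y : Fin n

  growth-unique : Growth S → Unique S
  growth-unique seed             = [] ∷ []
  growth-unique (grow g x∉ _ _ _) = ¬Any⇒All¬ _ x∉ ∷ growth-unique g

  -- Added g u v t: v was the t-th vertex to be added, as a neighbour of u; the root counts as
  -- a neighbour of itself.
  data Added : Growth S → Fin n → Fin n → ℕ → Set where
    root  : Added seed r r 0
    here  : ∀ {x p} {g : Growth S} {x∉ : x ∉ S} {p∈ : p ∈ S} {p~x : p ~ x}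
              {only : ∀ {y} → y ∈ S → y ~ x → y ≡ p} →
            Added (grow g x∉ p∈ p~x only) p x (length S)
    there : ∀ {x p t} {g : Growth S} {x∉ : x ∉ S} {p∈ : p ∈ S} {p~x : p ~ x}
              {only : ∀ {y} → y ∈ S → y ~ x → y ≡ p} →
            Added g u v t → Added (grow g x∉ p∈ p~x only) u v t

  root-added : (g : Growth S) → Added g r r 0
  root-added seed             = root
  root-added (grow g _ _ _ _) = there (root-added g)

  added-< : ∀ {t} {g : Growth S} → Added g u v t → t < length S
  added-< root      = s≤s z≤n
  added-< here      = n<1+n _
  added-< (there a) = m<n⇒m<1+n (added-< a)

  added-∈ : ∀ {t} {g : Growth S} → Added g u v t → v ∈ S
  added-∈ root      = here refl
  added-∈ here      = here refl
  added-∈ (there a) = there (added-∈ a)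

  -- A neighbour of `v` added before `v` is the parent of `v`, hence `u`. One added after `v` has
  -- only one earlier neighbour, which must be `v`.
  child-added : ∀ {t} {g : Growth S} → Added g u v t → x ∈ S → v ~ x → x ≢ u →
                ∃[ t′ ] (t < t′ × Added g v x t′)
  child-added root (here refl) v~x _ = ⊥-elim (~-irrefl v~x)
  child-added here (here refl) v~x _ = ⊥-elim (~-irrefl v~x)
  child-added (here {only = only}) (there x∈) v~x x≢u = ⊥-elim (x≢u (only x∈ (~-sym v~x)))
  child-added (there {only = only} a) (here refl) v~x _ with refl ← only (added-∈ a) v~x =
    _ , added-< a , here
  child-added (there a) (there x∈) v~x x≢u with child-added a x∈ v~x x≢u
  ... | t′ , t<t′ , a′ = t′ , t<t′ , there a′

  data Path : Fin n → Fin n → List (Fin n) → Set where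
    [_] : ∀ u → Path u u (u ∷ [])
    _∷_ : ∀ {us} → u ~ v → Path v w us → Path u w (u ∷ us)

  private variable
    us : List (Fin n)

  snoc : Path u v us → v ~ w → Path u w (us ++ w ∷ [])
  snoc [ _ ]     v~w = v~w ∷ [ _ ]
  snoc (u~u′ ∷ p) v~w = u~u′ ∷ snoc p v~w

  linked : Path u v us → Linked _~_ us
  linked [ _ ]                = [-]
  linked (u~v ∷ [ _ ])        = u~v ∷ [-]
  linked (u~v ∷ p@(_ ∷ _))    = u~v ∷ linked p

  path-length : Path u v us → u ≢ v → 2 ≤ length us
  path-length [ _ ]           u≢u = ⊥-elim (u≢u refl)
  path-length (_ ∷ [ _ ])     _   = s≤s (s≤s z≤n)
  path-length (_ ∷ (_ ∷ _))   _   = s≤s (s≤s z≤n)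

  -- The path is confined to `S`, so it can be prolonged or closed up through a vertex outside `S`
  -- without repetition.
  SimplyJoined : List (Fin n) → Set
  SimplyJoined S = ∀ {u v} → u ∈ S → v ∈ S → ∃[ us ] (Path u v us × Unique us × All (_∈ S) us)

  ∉-all : x ∉ S → All (_∈ S) us → All (x ≢_) us
  ∉-all x∉ = All.map (λ { u∈ refl → x∉ u∈ })

  joined-grow : x ∉ S → y ∈ S → y ~ x → SimplyJoined S → SimplyJoined (x ∷ S)
  joined-grow x∉ y∈ y~x J (here refl) (here refl) = _ , [ _ ] , [] ∷ [] , here refl ∷ []
  joined-grow x∉ y∈ y~x J (here refl) (there v∈) with J y∈ v∈
  ... | us , p , uniq , in-S =
    _ , ~-sym y~x ∷ p , ∉-all x∉ in-S ∷ uniq , here refl ∷ All.map there in-S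
  joined-grow x∉ y∈ y~x J (there u∈) (here refl) with J u∈ y∈
  ... | us , p , uniq , in-S =
    _ , snoc p y~x
    , Uniqueₚ.++⁺ uniq ([] ∷ []) (λ { (v∈ , here refl) → x∉ (All.lookup in-S v∈) })
    , Allₚ.++⁺ (All.map there in-S) (here refl ∷ [])
  joined-grow x∉ y∈ y~x J (there u∈) (there v∈) with J u∈ v∈
  ... | us , p , uniq , in-S = us , p , uniq , All.map there in-S

  -- Two different neighbours of `x` in `S` are joined by a simple path in `S`, and `x` would close
  -- it to a cycle.
  one-neighbour : (∀ u vs → ¬ IsCycle G u vs) → SimplyJoined S → x ∉ S →
                  y ∈ S → y ~ x → w ∈ S → w ~ x → w ≡ y
  one-neighbour {y = y} {w} acyclic J x∉ y∈ y~x w∈ w~x with w Finₚ.≟ y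
  ... | yes w≡y = w≡y
  ... | no  w≢y with J w∈ y∈
  ...   | us , p , uniq , in-S = ⊥-elim (acyclic _ us
    ( path-length p w≢y
    , ∉-all x∉ in-S ∷ uniq
    , linked (~-sym w~x ∷ snoc p y~x)))

  crossing : Star _~_ u v → u ∈ S → v ∉ S → ∃[ y ] ∃[ x ] (y ∈ S × x ∉ S × y ~ x)
  crossing ε u∈ v∉ = ⊥-elim (v∉ u∈)
  crossing {S = S} (_◅_ {j = w} u~w p) u∈ v∉ with w ∈? S
  ... | yes w∈ = crossing p w∈ v∉
  ... | no  w∉ = _ , _ , u∈ , w∉ , u~w

  spanning : (∀ v → Star _~_ r v) → (∀ u vs → ¬ IsCycle G u vs) →
             ∃[ S ] (Growth S × (∀ v → v ∈ S))
  spanning reach acyclic = extend n (m≤m+n n 1) seed (here refl) joined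
    where
    joined : SimplyJoined (r ∷ [])
    joined (here refl) (here refl) = _ , [ _ ] , [] ∷ [] , here refl ∷ []

    extend : ∀ k {S} → n ≤ k + length S → Growth S → r ∈ S → SimplyJoined S →
             ∃[ S ] (Growth S × (∀ v → v ∈ S))
    extend k {S} n≤ g r∈ J with Finₚ.all? (_∈? S)
    ... | yes all = S , g , all
    ... | no ¬all with Finₚ.¬∀⟶∃¬ n (_∈ S) (_∈? S) ¬all
    ...   | v , v∉ with crossing (reach v) r∈ v∉
    ...     | y , x , y∈ , x∉ , y~x with k | n≤
    ...       | suc k | n≤ =
      extend k (≤-trans n≤ (≤-reflexive (sym (+-suc k _))))
        (grow g x∉ y∈ y~x (one-neighbour acyclic J x∉ y∈ y~x))
        (there r∈) (joined-grow x∉ y∈ y~x J)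
    -- Without fuel `S` has at least n entries, so `x ∷ S` would list more than n distinct vertices.
    ...       | zero | n≤ =
      ⊥-elim (<⇒≱ (unique-length (x ∷ S) (¬Any⇒All¬ S x∉ ∷ growth-unique g)) n≤)

-- The recursion for partial colourings

δ : Fin n → Fin n → ℕ
δ i j = if does (i Finₚ.≟ j) then 1 else 0

Incr : Fin d → Vec (Fin n) d → Vec (Fin n) d → Set
Incr j k l = ∀ i → toℕ (lookup l i) ≡ δ i j + toℕ (lookup k i)

Good : (a b k : Vec (Fin n) d) → Set
Good a b k = ∀ j → toℕ (lookup k j) ≡ 0 ⊎ toℕ (lookup k j) ≡ toℕ (lookup a j)
                                        ⊎ toℕ (lookup k j) ≡ toℕ (lookup b j)

-- R k u v w: there is a colouring of the edges from v to its neighbours x ≠ u with x ≤ w, and of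
-- the edges beyond these x, which uses the j-th colour lookup k j times at v and is good at all
-- vertices beyond v.  A vertex is good if, for every j, the number of edges of the j-th colour
-- at it is 0, lookup a j or lookup b j.
module Recursion {n : ℕ} (G : Graph n) {c : ℕ} (a b : Vec (Fin n) c) where
  open Graph G using (_~_)

  State : Set₁
  State = Vec (Fin n) c → Fin n → Fin n → Fin n → Set

  -- `R k u v w` has already dealt with `w`. The situation before vertex 0, with nothing coloured,
  -- is therefore not a state and is split off.
  Prev : State → State
  Prev R k u v w =
    (toℕ w ≡ 0 × (∀ j → toℕ (lookup k j) ≡ 0)) ⊎ (∃[ w′ ] (toℕ w ≡ suc (toℕ w′) × R k u v w′))

  -- As `z` is the last vertex, `l` counts the edges from `x` to all its neighbours but `v`. The
  -- edge to `v` makes it `l⁺`, and only this full count has to be good.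
  Hangs : State → Fin n → Fin n → Fin c → Set
  Hangs R v x j = ∃[ l ] ∃[ l⁺ ] ∃[ z ] (suc (toℕ z) ≡ n × R l v x z × Incr j l l⁺ × Good a b l⁺)

  Skipped : (k′ k : Vec (Fin n) c) → (u v w : Fin n) → Set
  Skipped k′ k u v w = (¬ v ~ w ⊎ w ≡ u) × (∀ j → toℕ (lookup k j) ≡ toℕ (lookup k′ j))

  Taken : State → (k′ k : Vec (Fin n) c) → (u v w : Fin n) → Set
  Taken R k′ k u v w = v ~ w × w ≢ u × ∃[ j ] (Incr j k′ k × Hangs R v w j)

  Step : State → State
  Step R k u v w = ∃[ k′ ] (Prev R k′ u v w × (Skipped k′ k u v w ⊎ Taken R k′ k u v w))

  -- `R` occurs only positively in `Step`. This turns a step from sound table entries into a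
  -- derivation.
  Step-mono : ∀ {R R′ : State} → (∀ {k u v w} → R k u v w → R′ k u v w) →
              ∀ {k u v w} → Step R k u v w → Step R′ k u v w
  Step-mono ⊆ (k′ , prev , move) =
    k′ , Sum.map₂ (map₂ (map₂ ⊆)) prev ,
    Sum.map₂ (map₂ (map₂ (map₂ (map₂ (map₂ (map₂ (map₂ (map₂ λ (r , q) → ⊆ r , q)))))))) move

  data Derivable (k : Vec (Fin n) c) (u v w : Fin n) : Set where
    derive : Step Derivable k u v w → Derivable k u v w

-- The recursion as a first-order formula

pattern #0 = here refl
pattern #1 = there #0
pattern #2 = there #1
pattern #3 = there #2
pattern #4 = there #3
pattern #5 = there #4
pattern #6 = there #5
pattern #7 = there #6
pattern #8 = there #7
pattern #9 = there #8

every : ∀ k → (Fin k → Formula Γ) → Formula Γ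
every zero    φ = trueᶠ
every (suc k) φ = φ zero ∧ᶠ every k (φ ∘ suc)

some : ∀ k → (Fin k → Formula Γ) → Formula Γ
some zero    φ = neg trueᶠ
some (suc k) φ = φ zero ∨ᶠ some k (φ ∘ suc)

only : 1 ∈ Γ → Ref Γ
only x = 1 , x , zero

component : d ∈ Γ → Fin d → Ref Γ
component x i = _ , x , i

weaken-ref : Ref Γ → Ref (d ∷ Γ)
weaken-ref (_ , x , i) = _ , there x , i

isZero isLast : Ref Γ → Formula Γ
isZero r = neg (ex 1 (diff 1 (only #0) (weaken-ref r)))
isLast r = neg (ex 1 (diff 1 (weaken-ref r) (only #0)))

isIncr : Fin d → (k l : d ∈ Γ) → Formula Γ
isIncr j k l = every _ λ i → diff (δ i j) (component k i) (component l i)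

isGood : (a b k : d ∈ Γ) → Formula Γ
isGood a b k = every _ λ i → isZero (component k i)
  ∨ᶠ diff 0 (component a i) (component k i) ∨ᶠ diff 0 (component b i) (component k i)

edge : (u v : 1 ∈ Γ) → Formula Γ
edge u v = rel 0 (u ∷ v ∷ [])

Context : ℕ → List ℕ
Context c = c ∷ c ∷ c ∷ 1 ∷ 1 ∷ 1 ∷ []

module _ (c : ℕ) where

  -- The context lists a, b, k, u, v, w. Under the first quantifier `#0` is k′ and these six are
  -- `#1` to `#6`; in `prev` the bound w′ shifts all by one, and in `taken` the bound z, l⁺, l are
  -- `#0`, `#1`, `#2` and shift the rest by three.
  stepFormula : Formula (Context c)
  stepFormula = ex c (prev ∧ᶠ (skipped ∨ᶠ taken))
    where
    prev skipped taken : Formula (c ∷ Context c)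
    prev    = (isZero (only #6) ∧ᶠ every c λ j → isZero (component #0 j))
              ∨ᶠ ex 1 (diff 1 (only #0) (only #7) ∧ᶠ
                      rel 1 (#2 ∷ #3 ∷ #1 ∷ #5 ∷ #6 ∷ #0 ∷ []))
    skipped = (neg (edge #5 #6) ∨ᶠ diff 0 (only #4) (only #6)) ∧ᶠ
              every c λ j → diff 0 (component #0 j) (component #3 j)
    taken   = edge #5 #6 ∧ᶠ neg (diff 0 (only #4) (only #6)) ∧ᶠ some c λ j →
              isIncr j #0 #3 ∧ᶠ ex c (ex c (ex 1
                (isLast (only #0) ∧ᶠ
                 rel 1 (#4 ∷ #5 ∷ #2 ∷ #8 ∷ #9 ∷ #0 ∷ []) ∧ᶠ
                 isIncr j #2 #1 ∧ᶠ isGood #4 #5 #1)))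

  -- The root is entered as its own parent: there are no loops, so this excludes none of its
  -- neighbours. Any vertex will do, since soundness grows the tree anew from the vertex found.
  finalFormula : Formula []
  finalFormula = ex c (ex c (ex c (ex 1 (ex 1
    (isLast (only #0) ∧ᶠ rel 1 (#4 ∷ #3 ∷ #2 ∷ #1 ∷ #1 ∷ #0 ∷ []) ∧ᶠ
     isGood #4 #3 #2)))))

module _ {M : Arr → ℕ → ℕ} {ρ : Env n Γ} where

  every⇔ : ∀ k {φ : Fin k → Formula Γ} → ⟦ every k φ ⟧ M ρ ⇔ (∀ i → ⟦ φ i ⟧ M ρ)
  every⇔ zero    = mk⇔ (λ _ ()) (λ _ → tt)
  every⇔ (suc k) = mk⇔
    (λ { (p , q) zero → p ; (p , q) (suc i) → to (every⇔ k) q i })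
    (λ p → p zero , from (every⇔ k) (p ∘ suc))

  some⇔ : ∀ k {φ : Fin k → Formula Γ} → ⟦ some k φ ⟧ M ρ ⇔ (∃[ i ] ⟦ φ i ⟧ M ρ)
  some⇔ zero    = mk⇔ (λ ¬tt → ⊥-elim (¬tt tt)) (λ ())
  some⇔ (suc k) = mk⇔
    (λ { (inj₁ p) → zero , p ; (inj₂ q) → let i , p = to (some⇔ k) q in suc i , p })
    (λ { (zero , p) → inj₁ p ; (suc i , p) → inj₂ (from (some⇔ k) (i , p)) })

  isZero⇔ : (r : Ref Γ) → ⟦ isZero r ⟧ M ρ ⇔ toℕ (value ρ r) ≡ 0
  isZero⇔ r = mk⇔ fwd (λ { ≡0 (_ , ≡suc) → 1+n≢0 (trans (sym ≡suc) ≡0) })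
    where
    fwd : ⟦ isZero r ⟧ M ρ → toℕ (value ρ r) ≡ 0
    fwd ¬pred with toℕ (value ρ r) in eq
    ... | zero  = refl
    ... | suc m = ⊥-elim (¬pred (fromℕ< m<n ∷ [] , trans eq (cong suc (sym (toℕ-fromℕ< m<n)))))
      where
      m<n : m < n
      m<n = <-trans (n<1+n m) (subst (_< n) eq (toℕ<n (value ρ r)))

  isLast⇔ : (r : Ref Γ) → ⟦ isLast r ⟧ M ρ ⇔ suc (toℕ (value ρ r)) ≡ n
  isLast⇔ r = mk⇔ fwd
    (λ { ≡n (y ∷ [] , ≡suc) → <-irrefl (trans ≡suc ≡n) (toℕ<n y) })
    where
    fwd : ⟦ isLast r ⟧ M ρ → suc (toℕ (value ρ r)) ≡ n
    fwd ¬next with suc (toℕ (value ρ r)) <? n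
    ... | yes <n = ⊥-elim (¬next (fromℕ< <n ∷ [] , toℕ-fromℕ< <n))
    ... | no  ≮n = ≤-antisym (toℕ<n (value ρ r)) (≮⇒≥ ≮n)

  isGood⇔ : (a b k : d ∈ Γ) →
    ⟦ isGood a b k ⟧ M ρ ⇔ Good (All.lookup ρ a) (All.lookup ρ b) (All.lookup ρ k)
  isGood⇔ a b k = mk⇔
    (λ g j → Sum.map₁ (to (isZero⇔ (component k j))) (to (every⇔ _) g j))
    (λ g → from (every⇔ _) λ j → Sum.map₁ (from (isZero⇔ (component k j))) (g j))

  isIncr⇔ : ∀ j (k l : d ∈ Γ) → ⟦ isIncr j k l ⟧ M ρ ⇔ Incr j (All.lookup ρ k) (All.lookup ρ l)
  isIncr⇔ j k l = every⇔ _

-- The code of a pair is `combine u v` as a number, and `remQuot` inverts `combine`.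
matrixCell-code : (G : Graph n) (u v : Fin n) →
  matrixCell G (code 0 (Env n (1 ∷ 1 ∷ []) ∋ (u ∷ []) ∷ (v ∷ []) ∷ [])) ≢ 0 ⇔ Graph._~_ G u v
matrixCell-code {n} G u v with (0 * n + toℕ u) * n + toℕ v <? n * n
... | no ≮ = ⊥-elim (≮ (subst (_< n * n) code≡ (toℕ<n (combine u v))))
  where
  code≡ : toℕ (combine u v) ≡ (0 * n + toℕ u) * n + toℕ v
  code≡ = trans (Finₚ.toℕ-combine u v) (cong (_+ toℕ v) (*-comm n (toℕ u)))
... | yes lt = cell (cong (uncurry (EdgeSet.joins (edges G))) rq)
  where
  code≡ : toℕ (combine u v) ≡ (0 * n + toℕ u) * n + toℕ v
  code≡ = trans (Finₚ.toℕ-combine u v) (cong (_+ toℕ v) (*-comm n (toℕ u)))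

  rq : remQuot {n} n (fromℕ< lt) ≡ (u , v)
  rq = trans (cong (remQuot {n} n)
               (toℕ-injective (trans (toℕ-fromℕ< lt) (sym code≡))))
             (Finₚ.remQuot-combine u v)

  cell : ∀ {e e′} → e ≡ e′ → (if e then 1 else 0) ≢ 0 ⇔ T e′
  cell {true}  refl = mk⇔ _ (λ _ ())
  cell {false} refl = mk⇔ (λ ≢0 → ≢0 refl) (λ ())

Tabulated : ∀ {c} → (Arr → ℕ → ℕ) → (a b k : Vec (Fin n) c) → (u v w : Fin n) → Set
Tabulated {n} {c} M a b k u v w =
  M 1 (code 0 (Env n (Context c) ∋ a ∷ b ∷ k ∷ (u ∷ []) ∷ (v ∷ []) ∷ (w ∷ []) ∷ [])) ≢ 0

module _ {n : ℕ} (G : Graph n) {c : ℕ} (M : Arr → ℕ → ℕ) (base≡ : M 0 ≡ matrixCell G) where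

  edge⇔ : {ρ : Env n Γ} (x y : 1 ∈ Γ) →
    ⟦ edge x y ⟧ M ρ ⇔ Graph._~_ G (value ρ (only x)) (value ρ (only y))
  edge⇔ {ρ = ρ} x y with All.lookup ρ x | All.lookup ρ y
  ... | u ∷ [] | v ∷ [] rewrite base≡ = matrixCell-code G u v

  module _ (a b : Vec (Fin n) c) where
    open Recursion G a b

    step⇔ : ∀ {k u v w} →
      ⟦ stepFormula c ⟧ M (a ∷ b ∷ k ∷ (u ∷ []) ∷ (v ∷ []) ∷ (w ∷ []) ∷ []) ⇔
      Step (Tabulated M a b) k u v w
    step⇔ {k} {u} {v} {w} = mk⇔ fwd bwd
      where
      ρ : Env n (Context c)
      ρ = a ∷ b ∷ k ∷ (u ∷ []) ∷ (v ∷ []) ∷ (w ∷ []) ∷ []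

      fwd : ⟦ stepFormula c ⟧ M ρ → Step (Tabulated M a b) k u v w
      fwd (k′ , prev , move) = k′ ,
        (case prev of λ
          { (inj₁ (z , zs)) → inj₁ (to (isZero⇔ {M = M} {ρ = k′ ∷ ρ} (only #6)) z
                                   , λ j → to (isZero⇔ {M = M} {ρ = k′ ∷ ρ} (component #0 j))
                                              (to (every⇔ c) zs j))
          ; (inj₂ (w′ ∷ [] , eq , r)) → inj₂ (w′ , eq , r) }) ,
        (case move of λ
          { (inj₁ (¬e , same)) → inj₁
              (Sum.map (_∘ from (edge⇔ {ρ = k′ ∷ ρ} #5 #6)) toℕ-injective ¬e
              , to (every⇔ c) same)
          ; (inj₂ (e , w≢u , js)) → inj₂
              ( to (edge⇔ {ρ = k′ ∷ ρ} #5 #6) e , w≢u ∘ cong toℕ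
              , (case to (some⇔ c) js of λ
                  { (j , incr , l , l⁺ , z ∷ [] , last , r , incr′ , good) →
                    j , to (isIncr⇔ j #0 #3) incr , l , l⁺ , z
                    , to (isLast⇔ {M = M} {ρ = (z ∷ []) ∷ l⁺ ∷ l ∷ k′ ∷ ρ} (only #0)) last , r
                    , to (isIncr⇔ j #2 #1) incr′ , to (isGood⇔ #4 #5 #1) good })) })

      bwd : Step (Tabulated M a b) k u v w → ⟦ stepFormula c ⟧ M ρ
      bwd (k′ , prev , move) = k′ ,
        (case prev of λ
          { (inj₁ (z , zs)) → inj₁ (from (isZero⇔ {M = M} {ρ = k′ ∷ ρ} (only #6)) z
                                   , from (every⇔ c) λ j →
                                       from (isZero⇔ {M = M} {ρ = k′ ∷ ρ} (component #0 j)) (zs j))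
          ; (inj₂ (w′ , eq , r)) → inj₂ (w′ ∷ [] , eq , r) }) ,
        (case move of λ
          { (inj₁ (¬e , same)) → inj₁
              (Sum.map (_∘ to (edge⇔ {ρ = k′ ∷ ρ} #5 #6)) (cong toℕ) ¬e
              , from (every⇔ c) same)
          ; (inj₂ (e , w≢u , j , incr , l , l⁺ , z , last , r , incr′ , good)) → inj₂
              ( from (edge⇔ {ρ = k′ ∷ ρ} #5 #6) e , w≢u ∘ toℕ-injective
              , from (some⇔ c) (j , from (isIncr⇔ j #0 #3) incr , l , l⁺ , z ∷ []
                  , from (isLast⇔ {M = M} {ρ = (z ∷ []) ∷ l⁺ ∷ l ∷ k′ ∷ ρ} (only #0)) last , r
                  , from (isIncr⇔ j #2 #1) incr′ , from (isGood⇔ #4 #5 #1) good)) })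

  final⇔ : ⟦ finalFormula c ⟧ M (All.[] {P = Vec (Fin n)}) ⇔
    (∃[ a ] ∃[ b ] ∃[ k ] ∃[ r ] ∃[ z ]
      (suc (toℕ z) ≡ n × Tabulated M a b k r r z × Good a b k))
  final⇔ = mk⇔
    (λ { (a , b , k , r ∷ [] , z ∷ [] , last , t , good) →
         a , b , k , r , z ,
         to (isLast⇔ {M = M} {ρ = (z ∷ []) ∷ (r ∷ []) ∷ k ∷ b ∷ a ∷ []} (only #0)) last ,
         t , to (isGood⇔ #4 #3 #2) good })
    (λ (a , b , k , r , z , last , t , good) →
         a , b , k , r ∷ [] , z ∷ [] ,
         from (isLast⇔ {M = M} {ρ = (z ∷ []) ∷ (r ∷ []) ∷ k ∷ b ∷ a ∷ []} (only #0)) last ,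
         t , from (isGood⇔ #4 #3 #2) good)

-- Counting

count : (Fin n → Bool) → ℕ
count f = ∣ tabulate f ∣

count-cong : (∀ x → f x ≡ f′ x) → count f ≡ count f′
count-cong eq = cong ∣_∣ (tabulate-cong eq)

count-suc : ∀ w → f w ≡ false → f′ w ≡ true → (∀ x → x ≢ w → f′ x ≡ f x) →
            count f′ ≡ suc (count f)
count-suc {f = f} {f′ = f′} zero fw f′w eq
  rewrite fw | f′w = cong suc (count-cong λ x → eq (suc x) λ ())
count-suc {f = f} {f′ = f′} (suc w) fw f′w eq
  with f zero | f′ zero | eq zero (λ ())
... | true  | .true  | refl =
  cong suc (count-suc w fw f′w λ x x≢w → eq (suc x) (x≢w ∘ Finₚ.suc-injective))
... | false | .false | refl =
  count-suc w fw f′w λ x x≢w → eq (suc x) (x≢w ∘ Finₚ.suc-injective)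

count-none : (∀ x → f x ≡ false) → count f ≡ 0
count-none {zero}  none = refl
count-none {suc n} none rewrite none zero = count-none (none ∘ suc)

nonempty⇒∣∣≢0 : {p : Subset n} → Nonempty p → ∣ p ∣ ≢ 0
nonempty⇒∣∣≢0 {p = p} (x , x∈p) ≡0 =
  n≮0 (subst (∣ p Subset.- x ∣ <_) ≡0 (x∈p⇒∣p-x∣<∣p∣ x∈p))

∈-tabulate : ∀ {x} → x Subset.∈ tabulate f → f x ≡ true
∈-tabulate {f = f} {x} x∈ = trans (sym (lookup∘tabulate f x)) ([]=⇒lookup x∈)

does⇒ : {A : Set} (a? : Dec A) → does a? ≡ true → A
does⇒ (yes a) _ = a

T-does⇒ : {A : Set} (a? : Dec A) → T (does a?) → A
T-does⇒ a? = does⇒ a? ∘ to T-≡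

⇒T-does : {A : Set} (a? : Dec A) → A → T (does a?)
⇒T-does a? = from T-≡ ∘ dec-true a?

-- From derivations to partitions

module _ {c : ℕ} where

  _≟ᶜ_ : (x y : Maybe (Fin c)) → Dec (x ≡ y)
  _≟ᶜ_ = ≡-dec Finₚ._≟_

  uses : (Fin n → Maybe (Fin c)) → Fin c → ℕ
  uses g j = count λ x → does (g x ≟ᶜ just j)

  paint : (Fin n → Maybe (Fin c)) → Fin n → Fin c → Fin n → Maybe (Fin c)
  paint g w j x = if does (x Finₚ.≟ w) then just j else g x

  paint-≡ : (g : Fin n → Maybe (Fin c)) (w : Fin n) (j : Fin c) → paint g w j w ≡ just j
  paint-≡ g w j rewrite dec-true (w Finₚ.≟ w) refl = refl

  paint-≢ : (g : Fin n → Maybe (Fin c)) {w x : Fin n} (j : Fin c) → x ≢ w → paint g w j x ≡ g x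
  paint-≢ g {w} {x} j x≢w rewrite dec-false (x Finₚ.≟ w) x≢w = refl

  uses-paint : (g : Fin n → Maybe (Fin c)) {w : Fin n} (j : Fin c) → g w ≡ nothing →
               ∀ i → uses (paint g w j) i ≡ δ i j + uses g i
  uses-paint g {w} j gw i with i Finₚ.≟ j
  ... | yes refl = count-suc w (dec-false (_ ≟ᶜ _) (λ e → case trans (sym gw) e of λ ()))
                     (dec-true (_ ≟ᶜ _) (paint-≡ g w j))
                     (λ x x≢w → cong (λ y → does (y ≟ᶜ just j)) (paint-≢ g j x≢w))
  ... | no  i≢j  = count-cong same
    where
    same : ∀ x → does (paint g w j x ≟ᶜ just i) ≡ does (g x ≟ᶜ just i)
    same x with x Finₚ.≟ w
    ... | yes refl = trans (dec-false (just j ≟ᶜ just i) (i≢j ∘ sym ∘ just-injective))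
                       (sym (dec-false (_ ≟ᶜ _) (λ e → case trans (sym gw) e of λ ())))
    ... | no  _    = refl

module Soundness {n : ℕ} (G : Graph n) {c : ℕ} (a b : Vec (Fin n) c) (r : Fin n) where
  open Graph G using (_~_)
  open EdgeSet (edges G) using () renaming (sym to ~-sym; irrefl to ~-irrefl)
  open Recursion G a b
  open Rooted G r

  -- Only the edges at `v` get colours. Beyond a child just a derivation is kept, to be unfolded
  -- once the growing tree arrives there.
  record Partial (k : Vec (Fin n) c) (u v : Fin n) (m : ℕ) : Set where
    constructor partial
    field
      colour   : Fin n → Maybe (Fin c)
      usage    : ∀ j → uses colour j ≡ toℕ (lookup k j)
      coloured : ∀ {x j} → colour x ≡ just j → v ~ x × x ≢ u × toℕ x < m × Hangs Derivable v x j
      all      : ∀ {x} → v ~ x → x ≢ u → toℕ x < m → ∃[ j ] colour x ≡ just j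

  open Partial

  unpainted : ∀ {k u v m x} (p : Partial k u v m) → (v ~ x → x ≢ u → ¬ (toℕ x < m)) →
              colour p x ≡ nothing
  unpainted {x = x} p ¬x with colour p x in eq
  ... | nothing = refl
  ... | just j  with v~x , x≢u , x<m , _ ← coloured p eq = ⊥-elim (¬x v~x x≢u x<m)

  derivable⇒partial : ∀ {k u v w} → Derivable k u v w → Partial k u v (suc (toℕ w))
  derivable⇒partial {k} {u} {v} {w} (derive (k′ , prev , move)) = extend (before prev) move
    where
    before : Prev Derivable k′ u v w → Partial k′ u v (toℕ w)
    before (inj₁ (w≡0 , k′≡0)) = partial (λ _ → nothing)
      (λ j → trans (count-none {n} {λ _ → false} λ _ → refl) (sym (k′≡0 j))) (λ ())
      (λ _ _ x<w → ⊥-elim (n≮0 (subst (_ <_) w≡0 x<w)))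
    before (inj₂ (w′ , w≡ , d)) = subst (Partial k′ u v) (sym w≡) (derivable⇒partial d)

    extend : Partial k′ u v (toℕ w) → Skipped k′ k u v w ⊎ Taken Derivable k′ k u v w →
             Partial k u v (suc (toℕ w))
    extend p (inj₁ (skip-w , k≡)) = partial (colour p) (λ j → trans (usage p j) (sym (k≡ j)))
      (λ eq → let v~x , x≢u , x<w , h = coloured p eq in v~x , x≢u , m<n⇒m<1+n x<w , h)
      λ {x} v~x x≢u x≤w → case m<1+n⇒m<n∨m≡n x≤w of λ
        { (inj₁ x<w) → all p v~x x≢u x<w
        ; (inj₂ x≡w) → case toℕ-injective x≡w of λ
          { refl → ⊥-elim (Sum.[ (λ ¬v~w → ¬v~w v~x) , x≢u ] skip-w) } }
    extend p (inj₂ (v~w , w≢u , j , incr , hangs)) = partial (paint (colour p) w j)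
      (λ i → trans (uses-paint (colour p) j (unpainted p λ _ _ → <-irrefl refl) i)
               (trans (cong (δ i j +_) (usage p i)) (sym (incr i))))
      coloured′ all′
      where
      coloured′ : ∀ {x i} → paint (colour p) w j x ≡ just i →
                  v ~ x × x ≢ u × toℕ x < suc (toℕ w) × Hangs Derivable v x i
      coloured′ {x} eq with x Finₚ.≟ w
      ... | yes refl with refl ← eq = v~w , w≢u , ≤-refl , hangs
      ... | no  _ = let v~x , x≢u , x<w , h = coloured p eq in v~x , x≢u , m<n⇒m<1+n x<w , h

      all′ : ∀ {x} → v ~ x → x ≢ u → toℕ x < suc (toℕ w) → ∃[ i ] paint (colour p) w j x ≡ just i
      all′ {x} v~x x≢u x≤w with x Finₚ.≟ w
      ... | yes refl = j , refl
      ... | no  x≢w  = all p v~x x≢u (≤∧≢⇒< (m<1+n⇒m≤n x≤w) (x≢w ∘ toℕ-injective))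

  GoodUse : (Fin n → Maybe (Fin c)) → Set
  GoodUse g = ∀ j → uses g j ≡ 0 ⊎ uses g j ≡ toℕ (lookup a j) ⊎ uses g j ≡ toℕ (lookup b j)

  good-cong : ∀ {g g′} → (∀ x → g x ≡ g′ x) → GoodUse g → GoodUse g′
  good-cong {g} {g′} eq good j = subst (λ k → k ≡ 0 ⊎ k ≡ toℕ (lookup a j) ⊎ k ≡ toℕ (lookup b j))
    (count-cong {f = λ x → does (g x ≟ᶜ just j)} λ x → cong (λ e → does (e ≟ᶜ just j)) (eq x))
    (good j)

  good-use : ∀ {g k} → (∀ j → uses g j ≡ toℕ (lookup k j)) → Good a b k → GoodUse g
  good-use eq good j rewrite eq j = good j

  -- The invariant for growing the tree: all edges at vertices of `S` have colours, and across each
  -- edge that leaves `S` a derivation is waiting. Each end of an edge stores a colour of its own,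
  -- so symmetry makes sense only when both ends are in `S`.
  record Colouring (S : List (Fin n)) : Set where
    field
      colour   : Fin n → Fin n → Maybe (Fin c)
      coloured : ∀ {v x j} → v ∈ S → colour v x ≡ just j → v ~ x
      all      : ∀ {v x} → v ∈ S → v ~ x → ∃[ j ] colour v x ≡ just j
      symm     : ∀ {u v} → u ∈ S → v ∈ S → u ~ v → colour u v ≡ colour v u
      good     : ∀ {v} → v ∈ S → GoodUse (colour v)
      hangs    : ∀ {v x j} → v ∈ S → x ∉ S → colour v x ≡ just j → Hangs Derivable v x j

  -- When `x` joins, the edge from its parent `p` already has a colour κ and a derivation hanging
  -- from it. The derivation colours the other edges at `x`, and κ is copied for the edge back to
  -- `p`. Symmetry persists because `p` is the only neighbour of `x` in `S`.
  colouring : ∀ {k z S} → suc (toℕ z) ≡ n → Derivable k r r z → Good a b k → Growth S → Colouring S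
  colouring {k} {z} last d good-k seed = record
    { colour   = λ _ → colour p
    ; coloured = λ { (here refl) eq → proj₁ (coloured p eq) }
    ; all      = λ { (here refl) r~x → all p r~x (λ { refl → ~-irrefl r~x }) (toℕ<n _) }
    ; symm     = λ { (here refl) (here refl) r~r → ⊥-elim (~-irrefl r~r) }
    ; good     = λ { (here refl) → good-use {colour p} {k} (usage p) good-k }
    ; hangs    = λ { (here refl) _ eq → let _ , _ , _ , h = coloured p eq in h }
    }
    where
    p : Partial k r r n
    p = subst (Partial k r r) last (derivable⇒partial d)
  colouring last d good-k (grow {S} {x} {p} g x∉ p∈ p~x only-p) = extended
    where
    module C = Colouring (colouring last d good-k g)

    κ : Fin c
    κ = proj₁ (C.all p∈ p~x)

    p-x : C.colour p x ≡ just κ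
    p-x = proj₂ (C.all p∈ p~x)

    extended : Colouring (x ∷ S)
    extended with C.hangs p∈ x∉ p-x
    ... | l , l⁺ , z , last′ , d′ , incr , good-l⁺ = record
      { colour   = colour′
      ; coloured = λ { (here refl) eq → coloured-new (trans (sym new) eq)
                     ; (there v∈) eq → C.coloured v∈ (trans (sym (old v∈)) eq) }
      ; all      = λ { (here refl) x~y → map₂ (trans new) (all-new x~y)
                     ; (there v∈) v~y → map₂ (trans (old v∈)) (C.all v∈ v~y) }
      ; symm     = λ { (here refl) (here refl) x~x → ⊥-elim (~-irrefl x~x)
                     ; (here refl) (there v∈) x~v → symm-new v∈ x~v
                     ; (there v∈) (here refl) v~x → sym (symm-new v∈ (~-sym v~x))
                     ; (there u∈) (there v∈) u~v →
                         trans (old u∈) (trans (C.symm u∈ v∈ u~v) (sym (old v∈))) }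
      ; good     = λ { (here refl) → good-cong {h} (λ _ → sym new) good-new
                     ; (there v∈) → good-cong {C.colour _} (λ _ → sym (old v∈)) (C.good v∈) }
      ; hangs    = λ { (here refl) y∉ eq → hangs-new y∉ (trans (sym new) eq)
                     ; (there v∈) y∉ eq → C.hangs v∈ (y∉ ∘ there) (trans (sym (old v∈)) eq) }
      }
      where
      q : Partial l p x n
      q = subst (Partial l p x) last′ (derivable⇒partial d′)

      h : Fin n → Maybe (Fin c)
      h = paint (colour q) p κ

      colour′ : Fin n → Fin n → Maybe (Fin c)
      colour′ v y = if does (v Finₚ.≟ x) then h y else C.colour v y

      new : ∀ {y} → colour′ x y ≡ h y
      new rewrite dec-true (x Finₚ.≟ x) refl = refl

      old : ∀ {v y} → v ∈ S → colour′ v y ≡ C.colour v y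
      old {v} v∈ rewrite dec-false (v Finₚ.≟ x) (λ { refl → x∉ v∈ }) = refl

      coloured-new : ∀ {y i} → h y ≡ just i → x ~ y
      coloured-new {y} eq with y Finₚ.≟ p
      ... | yes refl = ~-sym p~x
      ... | no  _    = proj₁ (coloured q eq)

      all-new : ∀ {y} → x ~ y → ∃[ i ] h y ≡ just i
      all-new {y} x~y with y Finₚ.≟ p
      ... | yes refl = κ , refl
      ... | no  y≢p  = all q x~y y≢p (toℕ<n y)

      symm-new : ∀ {v} → v ∈ S → x ~ v → colour′ x v ≡ colour′ v x
      symm-new v∈ x~v with refl ← only-p v∈ (~-sym x~v) =
        trans new (trans (paint-≡ (colour q) p κ) (trans (sym p-x) (sym (old v∈))))

      good-new : GoodUse h
      good-new = good-use {h} {l⁺}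
        -- `q` leaves the edge to `p` blank, `p` being the excluded parent, so painting it raises
        -- the count of κ by one and turns `l` into `l⁺`.
        (λ i → trans (uses-paint (colour q) κ (unpainted q λ _ p≢p _ → p≢p refl) i)
                 (trans (cong (δ i κ +_) (usage q i)) (sym (incr i)))) good-l⁺

      hangs-new : ∀ {y i} → y ∉ x ∷ S → h y ≡ just i → Hangs Derivable x y i
      hangs-new {y} y∉ eq with y Finₚ.≟ p
      ... | yes refl = ⊥-elim (y∉ (there p∈))
      ... | no  _    = let _ , _ , _ , h = coloured q eq in h

  module _ {S} (C : Colouring S) (spans : ∀ v → v ∈ S) where
    private module C = Colouring C

    class : Fin c → EdgeSet n
    class i = record
      { joins  = λ u v → does (C.colour u v ≟ᶜ just i)
      ; sym    = λ {u} {v} t → let eq = T-does⇒ (_ ≟ᶜ _) t in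
          ⇒T-does (_ ≟ᶜ _) (trans (sym (C.symm (spans u) (spans v) (C.coloured (spans u) eq))) eq)
      ; irrefl = λ {u} t → ~-irrefl (C.coloured (spans u) (T-does⇒ (_ ≟ᶜ _) t))
      }

    colouring⇒partition : WeaklySemiregularPartition G c
    colouring⇒partition =
      record
        { part     = class
        ; within   = λ i {u} t → C.coloured (spans u) (T-does⇒ (_ ≟ᶜ _) t)
        ; covers   = λ {u} u~v → map₂ (⇒T-does (_ ≟ᶜ _)) (C.all (spans u) u~v)
        ; disjoint = λ {_} {_} {u} {v} t t′ → just-injective
            (trans (sym (T-does⇒ (C.colour u v ≟ᶜ _) t)) (T-does⇒ (C.colour u v ≟ᶜ _) t′))
        } ,
      λ i → toℕ (lookup a i) , toℕ (lookup b i) , λ {v} v∈ →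
        case C.good (spans v) i of λ
        -- Multiplicity 0 is allowed at a vertex, but here `v` is an endpoint of an edge of the
        -- class.
        { (inj₁ ≡0) → ⊥-elim (nonempty⇒∣∣≢0
            (does⇒ (nonempty? (neighbours (class i) v)) (∈-tabulate v∈)) ≡0)
        ; (inj₂ eq) → eq }

-- From partitions to derivations

bit : Bool → ℕ
bit e = if e then 1 else 0

¬T⇒≡false : ∀ {e} → ¬ T e → e ≡ false
¬T⇒≡false {false} _  = refl
¬T⇒≡false {true}  ¬t = ⊥-elim (¬t tt)

-- Adding `v` to the set still gives at most n elements. Since no vertex is its own neighbour, all
-- degrees and partial degrees can be stored as elements of `Fin n`.
count-< : ∀ {f : Fin n → Bool} v → f v ≡ false → count f < n
count-< {n} {f} v fv = subst (_≤ n) (count-suc {f = f} {f⁺} v fv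
    (cong (if_then true else f v) (dec-true (v Finₚ.≟ v) refl))
    (λ x x≢v → cong (if_then true else f x) (dec-false (x Finₚ.≟ v) x≢v)))
  (∣p∣≤n (tabulate f⁺))
  where
  f⁺ : Fin n → Bool
  f⁺ x = if does (x Finₚ.≟ v) then true else f x

before : ℕ → (Fin n → Bool) → Fin n → Bool
before m f x = f x ∧ does (toℕ x <? m)

except : Fin n → (Fin n → Bool) → Fin n → Bool
except u f x = f x ∧ not (does (x Finₚ.≟ u))

count-before-suc : ∀ (f : Fin n → Bool) w →
  count (before (suc (toℕ w)) f) ≡ bit (f w) + count (before (toℕ w) f)
count-before-suc f w with f w in fw
... | true  = count-suc w
  (trans (cong (f w ∧_) (dec-false (toℕ w <? toℕ w) (<-irrefl refl))) (∧-zeroʳ (f w)))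
  (cong₂ _∧_ fw (dec-true (toℕ w <? suc (toℕ w)) ≤-refl))
  (λ x x≢w → cong (f x ∧_) (does-⇔
    (mk⇔ (λ x≤w → ≤∧≢⇒< (m<1+n⇒m≤n x≤w) (x≢w ∘ toℕ-injective)) m<n⇒m<1+n) (_ <? _) (_ <? _)))
... | false = count-cong same
  where
  same : ∀ x → before (suc (toℕ w)) f x ≡ before (toℕ w) f x
  same x with x Finₚ.≟ w
  ... | yes refl rewrite fw = refl
  ... | no  x≢w  = cong (f x ∧_) (does-⇔
    (mk⇔ (λ x≤w → ≤∧≢⇒< (m<1+n⇒m≤n x≤w) (x≢w ∘ toℕ-injective)) m<n⇒m<1+n) (_ <? _) (_ <? _))

count-before-0 : (f : Fin n → Bool) → count (before 0 f) ≡ 0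
count-before-0 f = count-none λ x → ∧-zeroʳ (f x)

count-before-n : (f : Fin n → Bool) → count (before n f) ≡ count f
count-before-n f = count-cong λ x →
  trans (cong (f x ∧_) (dec-true (_ <? _) (toℕ<n x))) (∧-identityʳ (f x))

count-except : ∀ (f : Fin n → Bool) u → count f ≡ bit (f u) + count (except u f)
count-except f u with f u in fu
... | true  = count-suc u
  (trans (cong (λ e → f u ∧ not e) (dec-true (u Finₚ.≟ u) refl)) (∧-zeroʳ (f u))) fu
  (λ x x≢u → sym (trans (cong (λ e → f x ∧ not e) (dec-false (x Finₚ.≟ u) x≢u))
                    (∧-identityʳ (f x))))
... | false = count-cong same
  where
  same : ∀ x → f x ≡ except u f x
  same x with x Finₚ.≟ u
  ... | yes refl = trans fu (sym (∧-zeroʳ (f u)))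
  ... | no  _    = sym (∧-identityʳ (f x))

vector : ∀ {c} (h : Fin c → ℕ) → (∀ j → h j < n) → Vec (Fin n) c
vector h h< = tabulate λ j → fromℕ< (h< j)

lookup-vector : ∀ {c} (h : Fin c → ℕ) (h< : ∀ j → h j < n) j → toℕ (lookup (vector h h<) j) ≡ h j
lookup-vector h h< j = trans (cong toℕ (lookup∘tabulate _ j)) (toℕ-fromℕ< (h< j))

last-vertex : Fin n → ∃[ z ] suc (toℕ {n} z) ≡ n
last-vertex {suc n} _ = Fin.fromℕ n , cong suc (Finₚ.toℕ-fromℕ n)

module Completeness {n : ℕ} (G : Graph n) {c : ℕ} (r : Fin n) {S : List (Fin n)}
                    (g : Rooted.Growth G r S) (spans : ∀ v → v ∈ S)
                    (W : WeaklySemiregularPartition G c) where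
  open Graph G using (_~_)
  open Rooted G r using (Added; child-added)
  open Partition (proj₁ W)

  -- A degree is less than n, so a target degree n or more may be replaced by any other.
  fit : ℕ → Fin n
  fit a with a <? n
  ... | yes a<n = fromℕ< a<n
  ... | no  _   = r

  fit-≡ : ∀ {m a} → m < n → m ≡ a → m ≡ toℕ (fit a)
  fit-≡ {m} {a} m<n refl with a <? n
  ... | yes a<n = sym (toℕ-fromℕ< a<n)
  ... | no  a≮n = ⊥-elim (a≮n m<n)

  as bs : Vec (Fin n) c
  as = tabulate λ j → fit (proj₁ (proj₂ W j))
  bs = tabulate λ j → fit (proj₁ (proj₂ (proj₂ W j)))

  open Recursion G as bs

  joins : Fin c → Fin n → Fin n → Bool
  joins j = EdgeSet.joins (part j)

  deg : Fin n → Fin c → ℕ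
  deg v j = count (joins j v)

  deg-< : ∀ v j → deg v j < n
  deg-< v j = count-< v (¬T⇒≡false (EdgeSet.irrefl (part j)))

  used : (u v : Fin n) → ℕ → Fin c → ℕ
  used u v m j = count (before m (except u (joins j v)))

  used-< : ∀ u v m j → used u v m j < n
  used-< u v m j = count-< {f = before m (except u (joins j v))} v
    (cong (λ e → (e ∧ _) ∧ _) (¬T⇒≡false (EdgeSet.irrefl (part j))))

  Counts : Vec (Fin n) c → (u v : Fin n) → ℕ → Set
  Counts k u v m = ∀ j → toℕ (lookup k j) ≡ used u v m j

  good : ∀ v → Good as bs (vector (deg v) (deg-< v))
  good v j rewrite lookup-vector (deg v) (deg-< v) j | lookup∘tabulate (fit ∘ proj₁ ∘ proj₂ W) j
                 | lookup∘tabulate (fit ∘ proj₁ ∘ proj₂ ∘ proj₂ W) j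
    with nonempty? (neighbours (part j) v)
  ... | yes ne = inj₂ (Sum.map (fit-≡ (deg-< v j)) (fit-≡ (deg-< v j))
    (proj₂ (proj₂ (proj₂ W j)) (lookup⇒[]= v (endpoints (part j))
      (trans (lookup∘tabulate _ v) (dec-true (nonempty? (neighbours (part j) v)) ne)))))
  ... | no ¬ne = inj₁ (count-none λ x → ¬T⇒≡false λ t →
    ¬ne (x , lookup⇒[]= x (neighbours (part j) v) (trans (lookup∘tabulate _ x) (to T-≡ t))))

  bit-δ : ∀ {u v i} → T (joins i u v) → ∀ j → bit (joins j u v) ≡ δ j i
  bit-δ {u} {v} {i} t j with j Finₚ.≟ i
  ... | yes refl rewrite to T-≡ t = refl
  ... | no  j≢i  = cong bit (¬T⇒≡false λ t′ → j≢i (disjoint t′ t))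

  root-counts : Counts (vector (deg r) (deg-< r)) r r n
  root-counts j = trans (lookup-vector (deg r) (deg-< r) j)
    (trans (count-except (joins j r) r)
      (trans (cong (λ e → bit e + count (except r (joins j r)))
               (¬T⇒≡false (EdgeSet.irrefl (part j))))
        (sym (count-before-n (except r (joins j r))))))

  module _ {R : State} {u v w : Fin n} {k : Vec (Fin n) c} {t : ℕ}
           (added : Added g u v t) (counts : Counts k u v (suc (toℕ w)))
           (prev : ∀ {w′ k′} → toℕ w ≡ suc (toℕ w′) → Counts k′ u v (suc (toℕ w′)) → R k′ u v w′)
           (child : ∀ {x z l t′} → t < t′ → Added g v x t′ → Counts l v x (suc (toℕ z)) → R l v x z)
    where

    private
      k′ : Vec (Fin n) c
      k′ = vector (used u v (toℕ w)) (used-< u v (toℕ w))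

      k′≡ : Counts k′ u v (toℕ w)
      k′≡ = lookup-vector (used u v (toℕ w)) (used-< u v (toℕ w))

      new : ∀ j → toℕ (lookup k j) ≡ bit (except u (joins j v) w) + toℕ (lookup k′ j)
      new j = trans (counts j) (trans (count-before-suc (except u (joins j v)) w)
                (cong (bit (except u (joins j v) w) +_) (sym (k′≡ j))))

      previous : ∀ m → toℕ w ≡ m → Prev R k′ u v w
      previous zero    w≡0 = inj₁ (w≡0 , λ j → trans (k′≡ j)
        (trans (cong (λ m → used u v m j) w≡0) (count-before-0 (except u (joins j v)))))
      previous (suc m) w≡ = inj₂ (fromℕ< m<n , w≡′ , prev w≡′ λ j →
        trans (k′≡ j) (cong (λ m → used u v m j) w≡′))
        where
        m<n : m < n
        m<n = <-trans (n<1+n m) (subst (_< n) w≡ (toℕ<n w))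

        w≡′ : toℕ w ≡ suc (toℕ (fromℕ< m<n))
        w≡′ = trans w≡ (cong suc (sym (toℕ-fromℕ< m<n)))

      skip-bit : ¬ v ~ w ⊎ w ≡ u → ∀ j → except u (joins j v) w ≡ false
      skip-bit (inj₁ v≁w) j = cong (_∧ _) (¬T⇒≡false (v≁w ∘ within j))
      skip-bit (inj₂ refl) j = trans (cong (λ e → joins j v w ∧ not e) (dec-true (w Finₚ.≟ w) refl))
                                 (∧-zeroʳ (joins j v w))

      skipped : ¬ v ~ w ⊎ w ≡ u → Skipped k′ k u v w
      skipped why = why , λ j →
        trans (new j) (cong (λ e → bit e + toℕ (lookup k′ j)) (skip-bit why j))

      taken : v ~ w → w ≢ u → Taken R k′ k u v w
      taken v~w w≢u with covers v~w | child-added added (spans w) v~w w≢u | last-vertex w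
      ... | i , part-i | t′ , t<t′ , added′ | z , last =
        v~w , w≢u , i ,
        (λ j → trans (new j)
          (cong (_+ toℕ (lookup k′ j)) (trans (cong bit (kept j)) (bit-δ part-i j)))) ,
        l , vector (deg w) (deg-< w) , z , last ,
        child t<t′ added′ (λ j → trans (l≡ j) (cong (λ m → used v w m j) (sym last))) ,
        (λ j → trans (lookup-vector (deg w) (deg-< w) j)
          (trans (count-except (joins j w) v)
            (cong₂ _+_ (bit-δ (EdgeSet.sym (part i) part-i) j)
              (trans (sym (count-before-n (except v (joins j w)))) (sym (l≡ j)))))) ,
        good w
        where
        l : Vec (Fin n) c
        l = vector (used v w n) (used-< v w n)

        l≡ : Counts l v w n
        l≡ = lookup-vector (used v w n) (used-< v w n)

        kept : ∀ j → except u (joins j v) w ≡ joins j v w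
        kept j = trans (cong (λ e → joins j v w ∧ not e) (dec-false (w Finₚ.≟ u) w≢u))
                   (∧-identityʳ (joins j v w))

    -- The witnesses are the true colour counts of the given partition. `R` is consulted only at the
    -- predecessor of `w` for the same `u` and `v`, and at children of `v`, which are added after
    -- `v`; earlier sweeps have provided these entries.
    step : Step R k u v w
    step = k′ , previous (toℕ w) refl , move
      where
      move : Skipped k′ k u v w ⊎ Taken R k′ k u v w
      move with T? (EdgeSet.joins (edges G) v w) | w Finₚ.≟ u
      ... | no  v≁w | _       = inj₁ (skipped (inj₁ v≁w))
      ... | yes _   | yes w≡u = inj₁ (skipped (inj₂ w≡u))
      ... | yes v~w | no  w≢u = inj₂ (taken v~w w≢u)

-- The decision procedure

-- A proof that the program runs correctly contains the final store, and looking at variable 0 there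
-- settles `A`. No search through partitions is required.
runs⇒dec : ∀ {P s T} {A : Set} → Runs P s T (λ s → Accepting s ⇔ A) → Dec A
runs⇒dec (_ , s , _ , _ , D) = map′ (to D) (from D) (¬? (vars s 0 ≟ 0))

module Decision {n : ℕ} (G : Graph n) (full : vertices G ≡ Subset.⊤) (tree : IsTree G) (c : ℕ) where
  open Fixpoint (Context c) (stepFormula c) (finalFormula c)

  private
    WSP : Set
    WSP = WeaklySemiregularPartition G c

    span : ∀ r → ∃[ S ] (Rooted.Growth G r S × (∀ v → v ∈ S))
    span r = Rooted.spanning G r (λ v → proj₂ (proj₁ tree) (vertex r) (vertex v)) (proj₂ tree)
      where
      vertex : ∀ v → v Subset.∈ vertices G
      vertex v = subst (v Subset.∈_) (sym full) ∈⊤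

    r : Fin n
    r = proj₁ (proj₁ (proj₁ tree))

    S : List (Fin n)
    S = proj₁ (span r)

    g : Rooted.Growth G r S
    g = proj₁ (proj₂ (span r))

    spans : ∀ v → v ∈ S
    spans = proj₂ (proj₂ (span r))

    open Rooted G r using (Added; added-<; root-added; growth-unique)

    state : (a b k : Vec (Fin n) c) (u v w : Fin n) → Env n (Context c)
    state a b k u v w = a ∷ b ∷ k ∷ (u ∷ []) ∷ (v ∷ []) ∷ (w ∷ []) ∷ []

    Sound : Env n (Context c) → Set
    Sound (a ∷ b ∷ k ∷ (u ∷ []) ∷ (v ∷ []) ∷ (w ∷ []) ∷ []) = Recursion.Derivable G a b k u v w

    -- After i rounds of n sweeps each, the states at all v with n ≤ i + t are in the table, where v
    -- was the t-th vertex added to the tree; after j more sweeps so are those with w < j at the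
    -- next v.
    Reach : ℕ → ℕ → Env n (Context c) → Set
    Reach i j (a ∷ b ∷ k ∷ (u ∷ []) ∷ (v ∷ []) ∷ (w ∷ []) ∷ []) =
      ∃[ W ] (a ≡ Completeness.as G r g spans W × b ≡ Completeness.bs G r g spans W ×
              Completeness.Counts G r g spans W k u v (suc (toℕ w)) ×
              ∃[ t ] (Added g u v t × (n ≤ i + t ⊎ (n ≤ suc i + t × toℕ w < j))))

    closed : ∀ {M} → M 0 ≡ matrixCell G →
             (∀ ρ → Entry {n} (matrixCell G) Sound Reach M ρ → Sound ρ) →
             ∀ ρ → ⟦ stepFormula c ⟧ M ρ → Sound ρ
    closed {M} base≡ sound ρ@(a ∷ b ∷ k ∷ (u ∷ []) ∷ (v ∷ []) ∷ (w ∷ []) ∷ []) holds =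
      Recursion.derive (Recursion.Step-mono G a b {R = Tabulated M a b}
        {R′ = Recursion.Derivable G a b} (λ {k} {u} {v} {w} → sound (state a b k u v w))
        {k} {u} {v} {w} (to (step⇔ G M base≡ a b {k} {u} {v} {w}) holds))

    start : ∀ ρ → ¬ Reach 0 0 ρ
    start (_ ∷ _ ∷ _ ∷ (_ ∷ []) ∷ (_ ∷ []) ∷ (_ ∷ []) ∷ []) (_ , _ , _ , _ , t , added , inj₁ n≤t) =
      <⇒≱ (<-≤-trans (added-< added) (unique-length S (growth-unique g))) n≤t

    turn : ∀ i ρ → Reach (suc i) 0 ρ → Reach i n ρ
    turn i (_ ∷ _ ∷ _ ∷ (_ ∷ []) ∷ (_ ∷ []) ∷ (w ∷ []) ∷ [])
         (W , a≡ , b≡ , k≡ , t , added , inj₁ n≤) =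
      W , a≡ , b≡ , k≡ , t , added , inj₂ (n≤ , toℕ<n w)

    progress : ∀ {M} (i j : Fin n) → M 0 ≡ matrixCell G →
      (∀ ρ → Reach (toℕ i) (toℕ j) ρ → Entry {n} (matrixCell G) Sound Reach M ρ) →
      ∀ ρ → Reach (toℕ i) (suc (toℕ j)) ρ → ⟦ stepFormula c ⟧ M ρ
    progress {M} i j base≡ reached (a ∷ b ∷ k ∷ (u ∷ []) ∷ (v ∷ []) ∷ (w ∷ []) ∷ [])
             (W , refl , refl , k≡ , t , added , stage) =
      from (step⇔ G M base≡ a b {k} {u} {v} {w})
        (Completeness.step G r g spans W {R = Tabulated M a b} {u} {v} {w} {k} added k≡
        (λ {w′} {k′} w≡ k′≡ → reached (state a b k′ u v w′) (W , refl , refl , k′≡ , t , added ,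
          Sum.map₂ (map₂ λ w≤j → ≤-trans (≤-reflexive (sym w≡)) (m<1+n⇒m≤n w≤j)) stage))
        -- A child has t < t′, so n ≤ 1 + i + t gives n ≤ i + t′: its states were complete before
        -- this round began.
        (λ {x} {z} {l} {t′} t<t′ added′ l≡ → reached (state a b l v x z)
          (W , refl , refl , l≡ , t′ , added′ , inj₁ (≤-trans (Sum.[ m≤n⇒m≤1+n , proj₁ ] stage)
            (≤-trans (≤-reflexive (sym (+-suc (toℕ i) t))) (+-monoʳ-≤ (toℕ i) t<t′))))))

  accepts : ∀ {M} → Table (matrixCell G) Sound Reach n 0 M →
            ⟦ finalFormula c ⟧ M (All.[] {P = Vec (Fin n)}) ⇔ WSP
  accepts {M} t = mk⇔ fwd bwd
    where
    open Table t

    fwd : ⟦ finalFormula c ⟧ M All.[] → WSP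
    fwd holds with to (final⇔ G M base≡) holds
    ... | a , b , k , r′ , z , last , entry , good with span r′
    ...   | S′ , g′ , spans′ =
      colouring⇒partition (colouring last (sound (state a b k r′ r′ z) entry) good g′) spans′
      where open Soundness G a b r′

    bwd : WSP → ⟦ finalFormula c ⟧ M All.[]
    bwd W = from (final⇔ G M base≡) (as , bs , vector (deg r) (deg-< r) , r , z , last ,
        reached (state as bs (vector (deg r) (deg-< r)) r r z)
          (W , refl , refl ,
           (λ j → trans (root-counts j) (cong (λ m → used r r m j) (sym last))) ,
           0 , root-added g , inj₁ (m≤m+n n 0)) ,
        good r)
      where
      open Completeness G r g spans W
      z = proj₁ (last-vertex r)
      last = proj₂ (last-vertex r)

  decides : Runs program (input G) (programTime n) (λ s → Accepting s ⇔ WSP)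
  decides = weaken ≤-refl
    (λ (M , t , D) → mk⇔ (to (accepts t) ∘ to D) (from D ∘ from (accepts t)))
    (program-runs (matrixCell G) Sound Reach closed start progress turn refl refl (λ _ → refl))

  partition? : Dec WSP
  partition? = runs⇒dec decides

  1≤n : 1 ≤ n
  1≤n = ≤-<-trans z≤n (toℕ<n r)

-- Partitions into c classes and the minimum number of classes

emptyEdgeSet : EdgeSet n
emptyEdgeSet = record { joins = λ _ _ → false ; sym = λ () ; irrefl = λ () }

pad : (G : Graph n) → ∀ {k} → WeaklySemiregularPartition G k → WeaklySemiregularPartition G (suc k)
pad G (P , regular) =
  record
    { part     = λ { zero → emptyEdgeSet ; (suc i) → part i }
    ; within   = λ { (suc i) → within i }
    ; covers   = λ u~v → let i , t = covers u~v in suc i , t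
    ; disjoint = λ { {suc i} {suc j} t t′ → cong suc (disjoint t t′) }
    } ,
  λ { zero    → 0 , 0 , λ {v} v∈ → ⊥-elim (no-endpoint v∈)
    ; (suc i) → regular i }
  where
  open Partition P

  no-endpoint : ∀ {v} → ¬ v Subset.∈ endpoints emptyEdgeSet
  no-endpoint {v} v∈ = case ∈-tabulate {f = λ _ → false} (proj₂ neighbour) of λ ()
    where
    neighbour : Nonempty (neighbours emptyEdgeSet v)
    neighbour = does⇒ (nonempty? (neighbours emptyEdgeSet v)) (∈-tabulate v∈)

pad-≤ : (G : Graph n) → ∀ {k m} → k ≤′ m →
        WeaklySemiregularPartition G k → WeaklySemiregularPartition G m
pad-≤ G ≤′-refl       W = W
pad-≤ G (≤′-step k≤m) W = pad G (pad-≤ G k≤m W)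

-- To exhibit the minimum, one descends from c as long as one class fewer suffices, which the
-- decision tells. By padding with empty classes, failure at one number rules out all smaller ones.
wrAtMost⇔ : (G : Graph n) → (∀ k → Dec (WeaklySemiregularPartition G k)) →
            ∀ c → WrAtMost c G ⇔ WeaklySemiregularPartition G c
wrAtMost⇔ G partition? c =
  mk⇔ (λ (k , (W , _) , k≤c) → pad-≤ G (≤⇒≤′ k≤c) W) (least c)
  where
  least : ∀ c → WeaklySemiregularPartition G c → WrAtMost c G
  least zero    W = zero , (W , λ _ _ → z≤n) , z≤n
  least (suc c) W with partition? c
  ... | yes W′ = let k , wr , k≤c = least c W′ in k , wr , m≤n⇒m≤1+n k≤c
  ... | no  ¬W = suc c , (W , λ j V → ≰⇒> (λ j≤c → ¬W (pad-≤ G (≤⇒≤′ j≤c) V))) , ≤-refl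

open import Data.Fin.Subset using (⊤)

runs-⇔ : ∀ {P s T} {A B : Set} → A ⇔ B →
         Runs P s T (λ s → Accepting s ⇔ A) → Runs P s T (λ s → Accepting s ⇔ B)
runs-⇔ A⇔B = weaken ≤-refl λ D → mk⇔ (to A⇔B ∘ to D) (from D ∘ from A⇔B)

bounded : ∀ {P f} {Φ : ∀ {n} → Graph n → Store → Set} → IsPoly f →
  (∀ {n} (T : Graph n) → vertices T ≡ ⊤ → IsTree T → 1 ≤ n × Runs P (input T) (f n) (Φ T)) →
  ∃[ a ] ∃[ d ] (∀ {n} (T : Graph n) → vertices T ≡ ⊤ → IsTree T →
    Runs P (input T) (a * n ^ d) (Φ T))
bounded (a , d , f≤) runs = a , d , λ {n} T full tree →
  let 1≤n , run = runs T full tree in weaken (f≤ n 1≤n) id run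

theorem1 : ∀ (c : ℕ) → 1 ≤ c →
    ∃[ P ] ∃[ a ] ∃[ d ]
    (∀ {n} (T : Graph n) → vertices T ≡ ⊤ → IsTree T →
    ∃[ t ] ∃[ s ]
    ((P , input T ⇓[ t ] s) × t ≤ a * n ^ d × (Accepting s ⇔ WrAtMost c T)))
theorem1 c _ = program , bounded poly-programTime λ T full tree →
    Decision.1≤n T full tree c ,
    runs-⇔ (mk⇔ (from (wr T full tree)) (to (wr T full tree))) (Decision.decides T full tree c)
  where
  open Fixpoint (Context c) (stepFormula c) (finalFormula c)

  wr : ∀ {n} (T : Graph n) → vertices T ≡ ⊤ → IsTree T →
       WrAtMost c T ⇔ WeaklySemiregularPartition T c
  wr T full tree = wrAtMost⇔ T (Decision.partition? T full tree) c
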